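{- Let $n,k,t>0$ be integers with $k\ge t$. Let $\mathcal{C}\subset 2^{[N]}$ be a simplicial complex such that every inclusion-maximal set of $\mathcal{C}$ has size at least $n$, and assume $n\ge 2^{18}k^2\log_2 k$. Let $\mathcal{F}\subset\mathcal{C}^{(k)}$ be a $t$-intersecting family of maximum possible size. Then there exists a set $T$ of size $t$ such that $\mathcal{F}=\mathcal{C}^{(k)}[T]$. Moreover, if $\mathcal{F}$ is non-trivial, then $|\mathcal{F}|\le \frac12|\mathcal{C}^{(k)}[T]|$ for some $t$-element set $T$.
   Context: A simplicial complex $\mathcal{C}\subset 2^{[N]}$ is a family such that $A\in\mathcal{C}$ and $B\subset A$ imply $B\in\mathcal{C}$. $\mathcal{C}^{(k)}$ denotes the subfamily of all $k$-element sets of $\mathcal{C}$, and $\mathcal{C}^{(k)}[T]=\{F\in\mathcal{C}^{(k)}: T\subset F\}$. A family is $t$-intersecting if any two of its members (not necessarily distinct) share at least $t$ elements; a $t$-intersecting family $\mathcal{S}$ is non-trivial if $|\bigcap_{F\in\mathcal{S}}F|<t$. -}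

module Defs where

open import Data.Bool using (Bool; true; false; _∧_; if_then_else_)
open import Data.Nat using (ℕ; zero; suc; _+_; _≟_)
open import Data.List using (List; []; _∷_; _++_; map; foldr)
open import Data.Vec using (_∷_; [])
open import Data.Fin.Subset using (Subset; ∣_∣; _∩_; _⊆_; _⊂_; ⊤; ⊥; inside; outside)
open import Data.Fin.Subset.Properties using (_⊆?_)
open import Data.Product using (Σ; ∃; _×_)
open import Relation.Nullary using (¬_; does)
open import Relation.Binary.PropositionalEquality using (_≡_)

Family : ℕ → Set
Family N = Subset N → Bool

_∈F_ : ∀ {N} → Subset N → Family N → Set
A ∈F 𝓕 = 𝓕 A ≡ true

_⊆F_ : ∀ {N} → Family N → Family N → Set
𝓕 ⊆F 𝓖 = ∀ A → A ∈F 𝓕 → A ∈F 𝓖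

_≡F_ : ∀ {N} → Family N → Family N → Set
𝓕 ≡F 𝓖 = ∀ A → 𝓕 A ≡ 𝓖 A

allSubsets : (N : ℕ) → List (Subset N)
allSubsets zero = [] ∷ []
allSubsets (suc N) = map (inside ∷_) (allSubsets N) ++ map (outside ∷_) (allSubsets N)

size : ∀ {N} → Family N → ℕ
size {N} 𝓕 = foldr (λ A acc → (if 𝓕 A then 1 else 0) + acc) 0 (allSubsets N)

-- Intersection of all members of a family (the whole ground set for the empty family).
⋂F : ∀ {N} → Family N → Subset N
⋂F {N} 𝓕 = foldr (λ A acc → if 𝓕 A then A ∩ acc else acc) ⊤ (allSubsets N)

IsSimplicialComplex : ∀ {N} → Family N → Set
IsSimplicialComplex {N} 𝓒 =
  (⊥ ∈F 𝓒) × (∀ (A B : Subset N) → A ∈F 𝓒 → B ⊆ A → B ∈F 𝓒)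

IsMaximalIn : ∀ {N} → Subset N → Family N → Set
IsMaximalIn {N} A 𝓒 = (A ∈F 𝓒) × ¬ (Σ (Subset N) λ B → (B ∈F 𝓒) × (A ⊂ B))

layer : ∀ {N} → Family N → ℕ → Family N
layer 𝓒 k A = 𝓒 A ∧ does (∣ A ∣ ≟ k)

star : ∀ {N} → Family N → ℕ → Subset N → Family N
star 𝓒 k T A = layer 𝓒 k A ∧ does (T ⊆? A)

IsTIntersecting : ∀ {N} → ℕ → Family N → Set
IsTIntersecting {N} t 𝓕 = ∀ (A B : Subset N) → A ∈F 𝓕 → B ∈F 𝓕 → t Data.Nat.≤ ∣ A ∩ B ∣

IsNontrivial : ∀ {N} → ℕ → Family N → Set
IsNontrivial t 𝓕 = ∣ ⋂F 𝓕 ∣ Data.Nat.< t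

-- Write C[W] for the k-sets of the complex containing W.  Exchanging one element inside a maximal
-- face gives c |C[W]| ≤ |C[W - x]| for x ∈ W, where c = 64k; hence cᵐ |C[W]| ≤ M for |W| = t + m,
-- where M is the largest |C[T]| with |T| = t.
--
-- A non-trivial family is bounded by peeling.  Given a t-intersecting family of sets of size at
-- most i = t + m that have no common t-subset, saturate it to a t-intersecting family H inside its
-- down-closure, and split off the i-sets W ∈ H that contain no smaller member of H.  By saturation
-- every proper subset of such a W meets some member of H in fewer than t points, so a branching
-- argument shows that there are at most (8i)ᵐ of them, and together they capture at most M / 8ᵐ
-- of the k-sets.  Every other set contains a member of H of size below i.  If those members share
-- no t-set, recurse; if they all contain a t-set T, they also meet B₀ ─ T for a set B₀ of the
-- family not containing T, and so capture at most k · M / c k-sets.  The total is below M / 2.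
module Submission where

open import Defs
open import Data.Bool using (Bool; true; false; _∧_; if_then_else_)
import Data.Bool.Properties as Bool
open import Data.Empty using (⊥-elim)
open import Data.Fin using (Fin; zero; suc)
open import Data.Fin.Subset using (Subset; ∣_∣; _∈_; _∉_; _⊆_; _⊈_; _∩_; _∪_; _─_; _-_; ⊤; ⁅_⁆; inside; outside) renaming (⊥ to ∅)
open import Data.Fin.Subset.Properties
open import Data.List using (List; []; _∷_; _++_; map; foldr; tabulate; allFin; filter)
open import Data.List.Membership.Propositional using () renaming (_∈_ to _∈ₗ_)
open import Data.List.Membership.Propositional.Properties using (∈-allFin; ∈-map⁺; ∈-map⁻; ∈-++⁺ˡ; ∈-++⁺ʳ; ∈-filter⁺)
open import Data.List.Properties using (map-tabulate)
open import Data.List.Relation.Unary.All as All using ([]; _∷_)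
open import Data.List.Relation.Unary.All.Properties using (all-filter)
open import Data.List.Relation.Unary.Any using (here; there)
open import Data.List.Relation.Unary.Unique.Propositional using (Unique; []; _∷_)
import Data.List.Relation.Unary.Unique.Propositional.Properties as Unique
open import Data.Nat using (ℕ; zero; suc; _+_; _*_; _∸_; _^_; _≤_; _<_; _≟_; _≤?_; _<?_; z≤n; s≤s; NonZero; ⌊_/2⌋; >-nonZero; >-nonZero⁻¹)
open import Data.Nat.Properties hiding (_≟_; _≤?_; _<?_)
open import Data.List.Extrema ≤-totalOrder using (argmax; argmax-all; f[xs]≤f[argmax])
open import Data.Nat.Tactic.RingSolver using (solve-∀)
open import Data.Product using (Σ; ∃; _×_; _,_; proj₁; proj₂)
open import Data.Sum using (_⊎_; inj₁; inj₂)
open import Data.Vec as Vec using (_∷_; [])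
open import Data.Vec.Properties using (∷-injectiveʳ) renaming (≡-dec to ≡-decᵛ)
open import Function using (_∘_; mk⇔)
open import Relation.Binary.PropositionalEquality using (_≡_; _≢_; refl; sym; trans; cong; cong₂; subst; module ≡-Reasoning)
open import Relation.Nullary using (¬_; Dec; yes; no; does; contradiction)
open import Relation.Nullary.Decidable using (_×-dec_; _⊎-dec_; ¬?; dec-true; dec-false; decidable-stable)
open import Relation.Unary using (Decidable)
open import Relation.Unary.Properties using (∅?)

private variable
  X Y : Set

-- Counting the entries of a list that satisfy a decidable predicate

interchange : ∀ a b c d → (a + b) + (c + d) ≡ (a + c) + (b + d)
interchange = solve-∀

indicator : ∀ {P : Set} → Dec P → ℕ
indicator P? = if does P? then 1 else 0

# : {P : X → Set} → Decidable P → List X → ℕ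
# P? = foldr (λ x acc → indicator (P? x) + acc) 0

#-⊎ : {P : X → Set} {Q : X → Set} {R : X → Set} →
  (P? : Decidable P) (Q? : Decidable Q) (R? : Decidable R) →
  (∀ {x} → P x → Q x ⊎ R x) → (xs : List X) → # P? xs ≤ # Q? xs + # R? xs
#-⊎ P? Q? R? P⊆ [] = z≤n
#-⊎ P? Q? R? P⊆ (x ∷ xs) = begin
  indicator (P? x) + # P? xs
    ≤⟨ +-mono-≤ head (#-⊎ P? Q? R? P⊆ xs) ⟩
  (indicator (Q? x) + indicator (R? x)) + (# Q? xs + # R? xs)
    ≡⟨ interchange (indicator (Q? x)) (indicator (R? x)) (# Q? xs) (# R? xs) ⟩
  (indicator (Q? x) + # Q? xs) + (indicator (R? x) + # R? xs) ∎
  where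
  open ≤-Reasoning
  head : indicator (P? x) ≤ indicator (Q? x) + indicator (R? x)
  head with P? x | Q? x | R? x
  ... | no _  | _     | _     = z≤n
  ... | yes p | yes _ | _     = s≤s z≤n
  ... | yes p | no _  | yes _ = s≤s z≤n
  ... | yes p | no ¬q | no ¬r with P⊆ p
  ...   | inj₁ q = contradiction q ¬q
  ...   | inj₂ r = contradiction r ¬r

#-none : {P : X → Set} (P? : Decidable P) (xs : List X) → (∀ {x} → ¬ P x) → # P? xs ≡ 0
#-none P? [] ¬P = refl
#-none P? (x ∷ xs) ¬P rewrite dec-false (P? x) ¬P = #-none P? xs ¬P

#-mono : {P : X → Set} {Q : X → Set} (P? : Decidable P) (Q? : Decidable Q) → (∀ {x} → P x → Q x) →
  (xs : List X) → # P? xs ≤ # Q? xs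
#-mono P? Q? P⊆Q xs = begin
  # P? xs             ≤⟨ #-⊎ P? Q? ∅? (inj₁ ∘ P⊆Q) xs ⟩
  # Q? xs + # ∅? xs   ≡⟨ cong (# Q? xs +_) (#-none ∅? xs λ ()) ⟩
  # Q? xs + 0         ≡⟨ +-identityʳ _ ⟩
  # Q? xs             ∎
  where open ≤-Reasoning

#-mono-< : {P : X → Set} {Q : X → Set} (P? : Decidable P) (Q? : Decidable Q) →
  (∀ {x} → P x → Q x) → {xs : List X} {x : X} → x ∈ₗ xs → ¬ P x → Q x → # P? xs < # Q? xs
#-mono-< P? Q? P⊆Q {_ ∷ xs} {x} (here refl) ¬p q
  rewrite dec-false (P? x) ¬p | dec-true (Q? x) q = s≤s (#-mono P? Q? P⊆Q xs)
#-mono-< P? Q? P⊆Q {x ∷ _} (there y∈) ¬p q with P? x | Q? x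
... | no _ | no _ = #-mono-< P? Q? P⊆Q y∈ ¬p q
... | no _ | yes _ = m≤n⇒m≤1+n (#-mono-< P? Q? P⊆Q y∈ ¬p q)
... | yes _ | yes _ = s≤s (#-mono-< P? Q? P⊆Q y∈ ¬p q)
... | yes p | no ¬q = contradiction (P⊆Q p) ¬q

#-cong : {P : X → Set} {Q : X → Set} →
  (P? : Decidable P) (Q? : Decidable Q) → (∀ {x} → P x → Q x) → (∀ {x} → Q x → P x) →
  (xs : List X) → # P? xs ≡ # Q? xs
#-cong P? Q? P⊆Q Q⊆P xs = ≤-antisym (#-mono P? Q? P⊆Q xs) (#-mono Q? P? Q⊆P xs)

#-positive : {P : X → Set} (P? : Decidable P) {xs : List X} {x : X} → x ∈ₗ xs → P x → 1 ≤ # P? xs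
#-positive P? {x = x} (here refl) p rewrite dec-true (P? x) p = s≤s z≤n
#-positive P? (there x∈xs) p = ≤-trans (#-positive P? x∈xs p) (m≤n+m _ _)

#-absent : {P : X → Set} (P? : Decidable P) {xs : List X} → (∀ {x} → x ∈ₗ xs → ¬ P x) → # P? xs ≡ 0
#-absent P? {[]} ¬P = refl
#-absent P? {x ∷ xs} ¬P rewrite dec-false (P? x) (¬P (here refl)) = #-absent P? (¬P ∘ there)

#-subsingleton : {P : X → Set} (P? : Decidable P) {xs : List X} → Unique xs →
  (∀ {x y} → P x → P y → x ≡ y) → # P? xs ≤ 1
#-subsingleton P? [] _ = z≤n
#-subsingleton P? {x ∷ xs} (x∉ ∷ uniq) same with P? x
... | no _ = #-subsingleton P? uniq same
... | yes p = ≤-reflexive (cong suc (#-absent P? λ y∈xs q → All.lookup x∉ y∈xs (same p q)))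

#-map : {P : X → Set} (P? : Decidable P) (f : Y → X) (ys : List Y) → # P? (map f ys) ≡ # (P? ∘ f) ys
#-map P? f [] = refl
#-map P? f (y ∷ ys) = cong (indicator (P? (f y)) +_) (#-map P? f ys)

#-++ : {P : X → Set} (P? : Decidable P) (xs ys : List X) → # P? (xs ++ ys) ≡ # P? xs + # P? ys
#-++ P? [] ys = refl
#-++ P? (x ∷ xs) ys = trans (cong (indicator (P? x) +_) (#-++ P? xs ys)) (sym (+-assoc (indicator (P? x)) _ _))

-- Double counting along a decidable relation

module _ {T : X → Y → Set} (T? : ∀ x y → Dec (T x y)) where

  #pairs : List X → List Y → ℕ
  #pairs xs ys = foldr (λ x acc → # (T? x) ys + acc) 0 xs

  #pairs-[] : ∀ xs → #pairs xs [] ≡ 0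
  #pairs-[] [] = refl
  #pairs-[] (x ∷ xs) = #pairs-[] xs

  #pairs-∷ : ∀ xs y ys → #pairs xs (y ∷ ys) ≡ # (λ x → T? x y) xs + #pairs xs ys
  #pairs-∷ [] y ys = refl
  #pairs-∷ (x ∷ xs) y ys = begin
    (indicator (T? x y) + # (T? x) ys) + #pairs xs (y ∷ ys)
      ≡⟨ cong ((indicator (T? x y) + # (T? x) ys) +_) (#pairs-∷ xs y ys) ⟩
    (indicator (T? x y) + # (T? x) ys) + (# (λ x → T? x y) xs + #pairs xs ys)
      ≡⟨ interchange (indicator (T? x y)) _ _ _ ⟩
    (indicator (T? x y) + # (λ x → T? x y) xs) + (# (T? x) ys + #pairs xs ys) ∎
    where
    open ≡-Reasoning

  #pairs-lower : {P : X → Set} (P? : Decidable P) (xs : List X) (ys : List Y) (d : ℕ) →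
    (∀ {x} → P x → d ≤ # (T? x) ys) → d * # P? xs ≤ #pairs xs ys
  #pairs-lower P? [] ys d many = ≤-reflexive (*-zeroʳ d)
  #pairs-lower P? (x ∷ xs) ys d many with P? x
  ... | no _ = ≤-trans (#pairs-lower P? xs ys d many) (m≤n+m _ _)
  ... | yes p = ≤-trans (≤-reflexive (*-suc d _)) (+-mono-≤ (many p) (#pairs-lower P? xs ys d many))

  -- The factor `l` expresses a fibre bound of e / l without division.
  #pairs-upper : {Q : Y → Set} (Q? : Decidable Q) (xs : List X) (ys : List Y) (l e : ℕ) →
    (∀ {x y} → T x y → Q y) → (∀ {y} → Q y → l * # (λ x → T? x y) xs ≤ e) →
    l * #pairs xs ys ≤ e * # Q? ys
  #pairs-upper Q? xs [] l e T⊆Q few rewrite #pairs-[] xs | *-zeroʳ l = z≤n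
  #pairs-upper Q? xs (y ∷ ys) l e T⊆Q few with Q? y
  ... | no ¬q rewrite #pairs-∷ xs y ys | #-none (λ x → T? x y) xs (¬q ∘ T⊆Q) =
    #pairs-upper Q? xs ys l e T⊆Q few
  ... | yes q rewrite #pairs-∷ xs y ys | *-distribˡ-+ l (# (λ x → T? x y) xs) (#pairs xs ys) | *-suc e (# Q? ys) =
    +-mono-≤ (few q) (#pairs-upper Q? xs ys l e T⊆Q few)

  double-count : {P : X → Set} {Q : Y → Set} →
    (P? : Decidable P) (Q? : Decidable Q) (xs : List X) (ys : List Y) (d e : ℕ) →
    (∀ {x y} → T x y → Q y) →
    (∀ {x} → P x → d ≤ # (T? x) ys) →
    (∀ {y} → Q y → # (λ x → T? x y) xs ≤ e) →
    d * # P? xs ≤ e * # Q? ys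
  double-count P? Q? xs ys d e T⊆Q many few = begin
    d * # P? xs          ≤⟨ #pairs-lower P? xs ys d many ⟩
    #pairs xs ys         ≡⟨ *-identityˡ _ ⟨
    1 * #pairs xs ys     ≤⟨ #pairs-upper Q? xs ys 1 e T⊆Q (≤-trans (≤-reflexive (*-identityˡ _)) ∘ few) ⟩
    e * # Q? ys          ∎
    where open ≤-Reasoning

  -- Meant for fibres that are degrees, since these are known only through inequalities of the form
  -- c ^ m * deg ≤ M.
  scaled-cover-count : {P : X → Set} {Q : Y → Set} →
    (P? : Decidable P) (Q? : Decidable Q) (xs : List X) (ys : List Y) (l e : ℕ) →
    (∀ {x y} → T x y → Q y) →
    (∀ {x} → P x → ∃ λ y → y ∈ₗ ys × T x y) →
    (∀ {y} → Q y → l * # (λ x → T? x y) xs ≤ e) →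
    l * # P? xs ≤ e * # Q? ys
  scaled-cover-count P? Q? xs ys l e T⊆Q covered few = begin
    l * # P? xs         ≡⟨ cong (l *_) (*-identityˡ _) ⟨
    l * (1 * # P? xs)   ≤⟨ *-monoʳ-≤ l (#pairs-lower P? xs ys 1
                             λ p → let y , y∈ys , txy = covered p in #-positive (T? _) y∈ys txy) ⟩
    l * #pairs xs ys    ≤⟨ #pairs-upper Q? xs ys l e T⊆Q few ⟩
    e * # Q? ys         ∎
    where open ≤-Reasoning

  cover-count : {P : X → Set} {Q : Y → Set} →
    (P? : Decidable P) (Q? : Decidable Q) (xs : List X) (ys : List Y) (e : ℕ) →
    (∀ {x y} → T x y → Q y) →
    (∀ {x} → P x → ∃ λ y → y ∈ₗ ys × T x y) →
    (∀ {y} → Q y → # (λ x → T? x y) xs ≤ e) →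
    # P? xs ≤ e * # Q? ys
  cover-count P? Q? xs ys e T⊆Q covered few = ≤-trans (≤-reflexive (sym (*-identityˡ _)))
    (double-count P? Q? xs ys 1 e T⊆Q
      (λ p → let y , y∈ys , txy = covered p in #-positive (T? _) y∈ys txy) few)

  -- The injection is a relation, so that an image may come from an existential statement.
  -- Injectivity leaves each `y` at most one preimage, and `Unique xs` ensures that it is counted
  -- once.
  injection-count : {P : X → Set} {Q : Y → Set} →
    (P? : Decidable P) (Q? : Decidable Q) {xs : List X} (ys : List Y) → Unique xs →
    (∀ {x y} → T x y → Q y) →
    (∀ {x} → P x → ∃ λ y → y ∈ₗ ys × T x y) →
    (∀ {x x′ y} → T x y → T x′ y → x ≡ x′) →
    # P? xs ≤ # Q? ys
  injection-count P? Q? {xs} ys uniq T⊆Q covered injective = ≤-trans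
    (cover-count P? Q? xs ys 1 T⊆Q covered λ {y} _ → #-subsingleton (λ x → T? x y) uniq injective)
    (≤-reflexive (*-identityˡ _))

-- Enumeration of subsets, and sizes as counts

∈-allSubsets : ∀ {N} (A : Subset N) → A ∈ₗ allSubsets N
∈-allSubsets [] = here refl
∈-allSubsets (inside ∷ A) = ∈-++⁺ˡ (∈-map⁺ (inside ∷_) (∈-allSubsets A))
∈-allSubsets {suc N} (outside ∷ A) = ∈-++⁺ʳ (map (inside ∷_) (allSubsets N)) (∈-map⁺ (outside ∷_) (∈-allSubsets A))

allSubsets-unique : ∀ N → Unique (allSubsets N)
allSubsets-unique zero = [] ∷ []
allSubsets-unique (suc N) = Unique.++⁺
  (Unique.map⁺ ∷-injectiveʳ (allSubsets-unique N))
  (Unique.map⁺ ∷-injectiveʳ (allSubsets-unique N))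
  (λ (A∈ , B∈) → heads-differ (∈-map⁻ _ A∈) (∈-map⁻ _ B∈))
  where
  heads-differ : ∀ {A : Subset (suc N)} →
    (∃ λ B → B ∈ₗ allSubsets N × A ≡ inside ∷ B) → ¬ (∃ λ B → B ∈ₗ allSubsets N × A ≡ outside ∷ B)
  heads-differ (_ , _ , refl) (_ , _ , ())

#ˢ : ∀ {N} {P : Subset N → Set} → Decidable P → ℕ
#ˢ {N} P? = # P? (allSubsets N)

-- Passage from Boolean families, in which the theorem is stated, to decidable predicates, with
-- which the counting is done.
size≡#ˢ : ∀ {N} (𝓕 : Family N) {P : Subset N → Set} (P? : Decidable P) →
  (∀ {A} → A ∈F 𝓕 → P A) → (∀ {A} → P A → A ∈F 𝓕) → size 𝓕 ≡ #ˢ P?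
size≡#ˢ {N} 𝓕 P? 𝓕⊆P P⊆𝓕 = go (allSubsets N)
  where
  go : ∀ As → foldr (λ A acc → (if 𝓕 A then 1 else 0) + acc) 0 As ≡ # P? As
  go [] = refl
  go (A ∷ As) = cong₂ (λ b n → (if b then 1 else 0) + n) same (go As)
    where
    same : 𝓕 A ≡ does (P? A)
    same with 𝓕 A Bool.≟ true
    ... | yes A∈𝓕 = trans A∈𝓕 (sym (dec-true (P? A) (𝓕⊆P A∈𝓕)))
    ... | no A∉𝓕 = trans (Bool.¬-not A∉𝓕) (sym (dec-false (P? A) (A∉𝓕 ∘ P⊆𝓕)))

-- Lets a set of points serve as the index set of a double count.
∣p∣≡# : ∀ {N} (p : Subset N) → ∣ p ∣ ≡ # (_∈? p) (allFin N)
∣p∣≡# [] = refl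
∣p∣≡# {suc N} (s ∷ p) = trans (head s) (cong (indicator (zero ∈? (s ∷ p)) +_) tail)
  where
  head : ∀ s → ∣ s ∷ p ∣ ≡ indicator (zero ∈? (s ∷ p)) + ∣ p ∣
  head inside = refl
  head outside = refl
  open ≡-Reasoning
  tail : ∣ p ∣ ≡ # (_∈? (s ∷ p)) (tabulate suc)
  tail = begin
    ∣ p ∣                                  ≡⟨ ∣p∣≡# p ⟩
    # (_∈? p) (allFin N)                   ≡⟨ #-cong (_∈? p) (λ x → suc x ∈? (s ∷ p)) Vec.there drop-there (allFin N) ⟩
    # (λ x → suc x ∈? (s ∷ p)) (allFin N)  ≡⟨ #-map (_∈? (s ∷ p)) suc (allFin N) ⟨
    # (_∈? (s ∷ p)) (map suc (allFin N))   ≡⟨ cong (# (_∈? (s ∷ p))) (map-tabulate (λ x → x) suc) ⟩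
    # (_∈? (s ∷ p)) (tabulate suc)         ∎

-- Finite subsets

private variable
  N : ℕ
  p q : Subset N
  x : Fin N

x∈p─q⇒x∉q : ∀ (p q : Subset N) → x ∈ p ─ q → x ∉ q
x∈p─q⇒x∉q (_ ∷ p) (inside ∷ q) () Vec.here
x∈p─q⇒x∉q (_ ∷ p) (_ ∷ q) (Vec.there x∈) (Vec.there x∈q) = x∈p─q⇒x∉q p q x∈ x∈q

x∈p-y⇒x≢y : ∀ (p : Subset N) (y : Fin N) → x ∈ p - y → x ≢ y
x∈p-y⇒x≢y p y x∈ = x∉⁅y⁆⇒x≢y (x∈p─q⇒x∉q p ⁅ y ⁆ x∈)

⊆-or-witness : ∀ (p q : Subset N) → p ⊆ q ⊎ ∃ λ x → x ∈ p × x ∉ q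
⊆-or-witness p q with nonempty? (p ─ q)
... | yes (x , x∈) = inj₂ (x , p─q⊆p p q x∈ , x∈p─q⇒x∉q p q x∈)
... | no empty = inj₁ λ {x} x∈p → decidable-stable (x ∈? q) λ x∉q → empty (x , x∈p∧x∉q⇒x∈p─q x∈p x∉q)

∣p∣<∣q∣⇒∃∈q∉p : ∣ p ∣ < ∣ q ∣ → ∃ λ x → x ∈ q × x ∉ p
∣p∣<∣q∣⇒∃∈q∉p {p = p} {q} lt with ⊆-or-witness q p
... | inj₁ q⊆p = contradiction (p⊆q⇒∣p∣≤∣q∣ q⊆p) (<⇒≱ lt)
... | inj₂ w = w

p⊆q∧∣q∣≤∣p∣⇒p≡q : p ⊆ q → ∣ q ∣ ≤ ∣ p ∣ → p ≡ q
p⊆q∧∣q∣≤∣p∣⇒p≡q {p = p} {q} p⊆q le with ⊆-or-witness q p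
... | inj₁ q⊆p = ⊆-antisym p⊆q q⊆p
... | inj₂ w = contradiction le (<⇒≱ (p⊂q⇒∣p∣<∣q∣ (p⊆q , w)))

∣p∪q∣+∣p∩q∣≡∣p∣+∣q∣ : ∀ (p q : Subset N) → ∣ p ∪ q ∣ + ∣ p ∩ q ∣ ≡ ∣ p ∣ + ∣ q ∣
∣p∪q∣+∣p∩q∣≡∣p∣+∣q∣ [] [] = refl
∣p∪q∣+∣p∩q∣≡∣p∣+∣q∣ (outside ∷ p) (outside ∷ q) = ∣p∪q∣+∣p∩q∣≡∣p∣+∣q∣ p q
∣p∪q∣+∣p∩q∣≡∣p∣+∣q∣ (inside ∷ p) (outside ∷ q) = cong suc (∣p∪q∣+∣p∩q∣≡∣p∣+∣q∣ p q)
∣p∪q∣+∣p∩q∣≡∣p∣+∣q∣ (outside ∷ p) (inside ∷ q) =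
  trans (cong suc (∣p∪q∣+∣p∩q∣≡∣p∣+∣q∣ p q)) (sym (+-suc ∣ p ∣ ∣ q ∣))
∣p∪q∣+∣p∩q∣≡∣p∣+∣q∣ (inside ∷ p) (inside ∷ q) = cong suc
  (trans (+-suc ∣ p ∪ q ∣ ∣ p ∩ q ∣) (trans (cong suc (∣p∪q∣+∣p∩q∣≡∣p∣+∣q∣ p q)) (sym (+-suc ∣ p ∣ ∣ q ∣))))

∣p─q∣+∣p∩q∣≡∣p∣ : ∀ (p q : Subset N) → ∣ p ─ q ∣ + ∣ p ∩ q ∣ ≡ ∣ p ∣
∣p─q∣+∣p∩q∣≡∣p∣ [] [] = refl
∣p─q∣+∣p∩q∣≡∣p∣ (outside ∷ p) (outside ∷ q) = ∣p─q∣+∣p∩q∣≡∣p∣ p q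
∣p─q∣+∣p∩q∣≡∣p∣ (outside ∷ p) (inside ∷ q) = ∣p─q∣+∣p∩q∣≡∣p∣ p q
∣p─q∣+∣p∩q∣≡∣p∣ (inside ∷ p) (outside ∷ q) = cong suc (∣p─q∣+∣p∩q∣≡∣p∣ p q)
∣p─q∣+∣p∩q∣≡∣p∣ (inside ∷ p) (inside ∷ q) = trans (+-suc ∣ p ─ q ∣ ∣ p ∩ q ∣) (cong suc (∣p─q∣+∣p∩q∣≡∣p∣ p q))

∣p∪q∣≡∣p∣+∣q∣ : (∀ {x} → x ∈ p → x ∉ q) → ∣ p ∪ q ∣ ≡ ∣ p ∣ + ∣ q ∣
∣p∪q∣≡∣p∣+∣q∣ {N} {p} {q} disjoint = begin
  ∣ p ∪ q ∣              ≡⟨ +-identityʳ _ ⟨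
  ∣ p ∪ q ∣ + 0          ≡⟨ cong (∣ p ∪ q ∣ +_) (∣⊥∣≡0 N) ⟨
  ∣ p ∪ q ∣ + ∣ ∅ {N} ∣  ≡⟨ cong (λ s → ∣ p ∪ q ∣ + ∣ s ∣) (Empty-unique λ (x , x∈) → let x∈p , x∈q = x∈p∩q⁻ p q x∈ in disjoint x∈p x∈q) ⟨
  ∣ p ∪ q ∣ + ∣ p ∩ q ∣  ≡⟨ ∣p∪q∣+∣p∩q∣≡∣p∣+∣q∣ p q ⟩
  ∣ p ∣ + ∣ q ∣          ∎
  where open ≡-Reasoning

∣p∪⁅x⁆∣≡1+∣p∣ : x ∉ p → ∣ p ∪ ⁅ x ⁆ ∣ ≡ suc ∣ p ∣
∣p∪⁅x⁆∣≡1+∣p∣ {x = x} {p} x∉p = begin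
  ∣ p ∪ ⁅ x ⁆ ∣      ≡⟨ ∣p∪q∣≡∣p∣+∣q∣ (λ y∈p y∈x → x∉p (subst (_∈ p) (x∈⁅y⁆⇒x≡y x y∈x) y∈p)) ⟩
  ∣ p ∣ + ∣ ⁅ x ⁆ ∣  ≡⟨ cong (∣ p ∣ +_) (∣⁅x⁆∣≡1 x) ⟩
  ∣ p ∣ + 1          ≡⟨ +-comm ∣ p ∣ 1 ⟩
  suc ∣ p ∣          ∎
  where open ≡-Reasoning

p∪⁅x⁆⊆q : p ⊆ q → x ∈ q → p ∪ ⁅ x ⁆ ⊆ q
p∪⁅x⁆⊆q {p = p} {q} {x} p⊆q x∈q y∈ with x∈p∪q⁻ p ⁅ x ⁆ y∈
... | inj₁ y∈p = p⊆q y∈p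
... | inj₂ y∈x = subst (_∈ q) (sym (x∈⁅y⁆⇒x≡y x y∈x)) x∈q

x∉p-x : ∀ (p : Subset N) (x : Fin N) → x ∉ p - x
x∉p-x p x x∈ = x∈p-y⇒x≢y p x x∈ refl

p-x∪⁅x⁆≡p : x ∈ p → (p - x) ∪ ⁅ x ⁆ ≡ p
p-x∪⁅x⁆≡p {x = x} {p} x∈p = ⊆-antisym (p∪⁅x⁆⊆q (p─q⊆p p ⁅ x ⁆) x∈p) back
  where
  back : p ⊆ (p - x) ∪ ⁅ x ⁆
  back {y} y∈p with y ∈? ⁅ x ⁆
  ... | yes y∈x = q⊆p∪q (p - x) ⁅ x ⁆ y∈x
  ... | no y∉x = p⊆p∪q ⁅ x ⁆ (x∈p∧x∉q⇒x∈p─q y∈p y∉x)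

∣p∣≡1+∣p-x∣ : x ∈ p → ∣ p ∣ ≡ suc ∣ p - x ∣
∣p∣≡1+∣p-x∣ {x = x} {p} x∈p =
  trans (cong ∣_∣ (sym (p-x∪⁅x⁆≡p x∈p))) (∣p∪⁅x⁆∣≡1+∣p∣ (x∉p-x p x))

-x-injective : x ∈ p → x ∈ q → p - x ≡ q - x → p ≡ q
-x-injective {x = x} x∈p x∈q eq =
  trans (sym (p-x∪⁅x⁆≡p x∈p)) (trans (cong (_∪ ⁅ x ⁆) eq) (p-x∪⁅x⁆≡p x∈q))

subset-of-size : ∀ (p : Subset N) m → m ≤ ∣ p ∣ → ∃ λ q → q ⊆ p × ∣ q ∣ ≡ m
subset-of-size {N} p zero _ = ∅ , ⊥-elim ∘ ∉⊥ , ∣⊥∣≡0 N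
subset-of-size (outside ∷ p) (suc m) le =
  let q , q⊆p , ∣q∣ = subset-of-size p (suc m) le in outside ∷ q , out⊆ q⊆p , ∣q∣
subset-of-size (inside ∷ p) (suc m) (s≤s le) =
  let q , q⊆p , ∣q∣ = subset-of-size p m le in inside ∷ q , in⊆in q⊆p , cong suc ∣q∣

_≟ˢ_ : ∀ (p q : Subset N) → Dec (p ≡ q)
_≟ˢ_ = ≡-decᵛ Bool._≟_

p⊆q-x : p ⊆ q → x ∉ p → p ⊆ q - x
p⊆q-x {p = p} p⊆q x∉p y∈p = x∈p∧x≢y⇒x∈p-y (p⊆q y∈p) λ y≡x → x∉p (subst (_∈ p) y≡x y∈p)

-x-mono : p ⊆ q → p - x ⊆ q - x
-x-mono {p = p} {x = x} p⊆q y∈ =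
  x∈p∧x≢y⇒x∈p-y (p⊆q (p─q⊆p p ⁅ x ⁆ y∈)) (x∈p-y⇒x≢y p x y∈)

extend-to-maximal : (𝓒 : Family N) → ∀ A → A ∈F 𝓒 → ∃ λ M → A ⊆ M × IsMaximalIn M 𝓒
extend-to-maximal {N} 𝓒 A A∈𝓒 = go N A A∈𝓒 (m≤n+m N _)
  where
  -- `fuel` bounds how often the set can still grow: each proper superset gains an element, and no
  -- set has more than N.
  go : ∀ fuel A → A ∈F 𝓒 → N ≤ ∣ A ∣ + fuel → ∃ λ M → A ⊆ M × IsMaximalIn M 𝓒
  go fuel A A∈𝓒 enough with anySubset? (λ B → (𝓒 B Bool.≟ true) ×-dec (A ⊂? B))
  ... | no maximal = A , (λ x∈ → x∈) , A∈𝓒 , maximal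
  go zero A A∈𝓒 enough | yes (B , _ , A⊂B) =
    contradiction (subst (N ≤_) (+-identityʳ _) enough)
      (<⇒≱ (<-≤-trans (p⊂q⇒∣p∣<∣q∣ A⊂B) (∣p∣≤n B)))
  go (suc fuel) A A∈𝓒 enough | yes (B , B∈𝓒 , A⊂B) =
    let M , B⊆M , maximal = go fuel B B∈𝓒
          (≤-trans enough (≤-trans (≤-reflexive (+-suc _ fuel)) (+-monoˡ-≤ fuel (p⊂q⇒∣p∣<∣q∣ A⊂B))))
    in M , ⊆-trans (p⊂q⇒p⊆q A⊂B) B⊆M , maximal

-- Degrees in a complex whose maximal faces are large

module Complex {N n : ℕ} (𝓒 : Family N) (complex : IsSimplicialComplex 𝓒)
  (large : ∀ A → IsMaximalIn A 𝓒 → n ≤ ∣ A ∣) (k : ℕ) where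

  Star : Subset N → Subset N → Set
  Star W A = (A ∈F 𝓒 × ∣ A ∣ ≡ k) × W ⊆ A

  star? : ∀ W → Decidable (Star W)
  star? W A = ((𝓒 A Bool.≟ true) ×-dec (∣ A ∣ ≟ k)) ×-dec (W ⊆? A)

  deg : Subset N → ℕ
  deg W = #ˢ (star? W)

  -- Double count of pairs (A, B) with A - x ⊆ B. A k-set A over W lies in a maximal face M, and
  -- exchanging x for any of the at least r points of M ─ A gives a different B over W - x.
  -- Conversely, A - x arises from B by deleting one of its k points.
  deg-remove : ∀ {W x r} → r + k ≤ n → x ∈ W → r * deg W ≤ k * deg (W - x)
  deg-remove {W} {x} {r} r+k≤n x∈W =
    double-count T? (star? W) (star? (W - x)) (allSubsets N) (allSubsets N) r k
      (proj₁ ∘ proj₂) many few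
    where
    T : Subset N → Subset N → Set
    T A B = Star W A × Star (W - x) B × A - x ⊆ B

    T? : ∀ A B → Dec (T A B)
    T? A B = star? W A ×-dec star? (W - x) B ×-dec (A - x ⊆? B)

    many : ∀ {A} → Star W A → r ≤ #ˢ (T? A)
    many {A} A∈@((A∈𝓒 , ∣A∣≡k) , W⊆A) with extend-to-maximal 𝓒 A A∈𝓒
    ... | M , A⊆M , maximal@(M∈𝓒 , _) = begin
      r                               ≤⟨ +-cancelʳ-≤ k r _ room ⟩
      ∣ M ─ A ∣                        ≡⟨ ∣p∣≡# (M ─ A) ⟩
      # (_∈? (M ─ A)) (allFin N)      ≤⟨ injection-count swap? (_∈? (M ─ A)) (T? A) (allSubsets N) (Unique.allFin⁺ N)
                                           swap⇒T (λ y∈ → _ , ∈-allSubsets _ , y∈ , refl) same ⟩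
      #ˢ (T? A)                       ∎
      where
      open ≤-Reasoning
      room : r + k ≤ ∣ M ─ A ∣ + k
      room = begin
        r + k                      ≤⟨ r+k≤n ⟩
        n                          ≤⟨ large M maximal ⟩
        ∣ M ∣                      ≡⟨ ∣p─q∣+∣p∩q∣≡∣p∣ M A ⟨
        ∣ M ─ A ∣ + ∣ M ∩ A ∣      ≤⟨ +-monoʳ-≤ ∣ M ─ A ∣ (∣p∩q∣≤∣q∣ M A) ⟩
        ∣ M ─ A ∣ + ∣ A ∣          ≡⟨ cong (∣ M ─ A ∣ +_) ∣A∣≡k ⟩
        ∣ M ─ A ∣ + k              ∎
      x∈A : x ∈ A
      x∈A = W⊆A x∈W
      Swap : Fin N → Subset N → Set
      Swap y B = y ∈ M ─ A × B ≡ (A - x) ∪ ⁅ y ⁆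
      swap? : ∀ y B → Dec (Swap y B)
      swap? y B = (y ∈? (M ─ A)) ×-dec (B ≟ˢ ((A - x) ∪ ⁅ y ⁆))
      swap⇒T : ∀ {y B} → Swap y B → T A B
      swap⇒T {y} (y∈ , refl) =
        A∈ ,
        ((proj₂ complex M _ M∈𝓒 (p∪⁅x⁆⊆q (⊆-trans (p─q⊆p A ⁅ x ⁆) A⊆M) (p─q⊆p M A y∈)) ,
          trans (∣p∪⁅x⁆∣≡1+∣p∣ (x∈p─q⇒x∉q M A y∈ ∘ p─q⊆p A ⁅ x ⁆)) (trans (sym (∣p∣≡1+∣p-x∣ x∈A)) ∣A∣≡k)) ,
          ⊆-trans (-x-mono W⊆A) (p⊆p∪q ⁅ y ⁆)) ,
        p⊆p∪q ⁅ y ⁆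
      same : ∀ {B y z} → Swap y B → Swap z B → y ≡ z
      same {B} {y} {z} (y∈ , refl) (z∈ , eq) with x∈p∪q⁻ (A - x) ⁅ z ⁆ (subst (y ∈_) eq (q⊆p∪q (A - x) ⁅ y ⁆ (x∈⁅x⁆ y)))
      ... | inj₁ y∈A-x = contradiction (p─q⊆p A ⁅ x ⁆ y∈A-x) (x∈p─q⇒x∉q M A y∈)
      ... | inj₂ y∈z = x∈⁅y⁆⇒x≡y z y∈z

    few : ∀ {B} → Star (W - x) B → #ˢ (λ A → T? A B) ≤ k
    few {B} ((_ , ∣B∣≡k) , _) = begin
      #ˢ (λ A → T? A B)          ≤⟨ injection-count drop? (λ A → T? A B) (_∈? B) (allFin N) (allSubsets-unique N)
                                      proj₁ dropped
                                      (λ (_ , x∈A , eq) (_ , x∈A′ , eq′) → -x-injective x∈A x∈A′ (trans eq (sym eq′))) ⟩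
      # (_∈? B) (allFin N)       ≡⟨ ∣p∣≡# B ⟨
      ∣ B ∣                      ≡⟨ ∣B∣≡k ⟩
      k                          ∎
      where
      open ≤-Reasoning
      -- The deleted point `y` determines `A`: the set `B - y` is `A - x`, and `x` is then put back.
      Drop : Subset N → Fin N → Set
      Drop A y = y ∈ B × x ∈ A × A - x ≡ B - y
      drop? : ∀ A y → Dec (Drop A y)
      drop? A y = (y ∈? B) ×-dec (x ∈? A) ×-dec ((A - x) ≟ˢ (B - y))
      dropped : ∀ {A} → T A B → ∃ λ y → y ∈ₗ allFin N × Drop A y
      dropped {A} (((_ , ∣A∣≡k) , W⊆A) , _ , A-x⊆B) = y , ∈-allFin y , y∈B , x∈A ,
        p⊆q∧∣q∣≤∣p∣⇒p≡q (p⊆q-x A-x⊆B y∉) (≤-pred (≤-reflexive (trans (sym (∣p∣≡1+∣p-x∣ y∈B)) (trans ∣B∣≡∣A∣ (∣p∣≡1+∣p-x∣ x∈A)))))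
        where
        x∈A : x ∈ A
        x∈A = W⊆A x∈W
        ∣B∣≡∣A∣ : ∣ B ∣ ≡ ∣ A ∣
        ∣B∣≡∣A∣ = trans ∣B∣≡k (sym ∣A∣≡k)
        found : ∃ λ y → y ∈ B × y ∉ A - x
        found = ∣p∣<∣q∣⇒∃∈q∉p (≤-reflexive (trans (sym (∣p∣≡1+∣p-x∣ x∈A)) (sym ∣B∣≡∣A∣)))
        y = proj₁ found
        y∈B = proj₁ (proj₂ found)
        y∉ = proj₂ (proj₂ found)

-- Branching over minimal members of a t-intersecting family

∣p∣≤1+∣p-x∣ : ∀ (p : Subset N) x → ∣ p ∣ ≤ suc ∣ p - x ∣
∣p∣≤1+∣p-x∣ p x with x ∈? p
... | yes x∈p = ≤-reflexive (∣p∣≡1+∣p-x∣ x∈p)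
... | no x∉p = ≤-trans (p⊆q⇒∣p∣≤∣q∣ (p⊆q-x (λ y∈ → y∈) x∉p)) (n≤1+n _)

∪-least : ∀ {p q r : Subset N} → p ⊆ r → q ⊆ r → p ∪ q ⊆ r
∪-least {p = p} {q} p⊆r q⊆r y∈ with x∈p∪q⁻ p q y∈
... | inj₁ y∈p = p⊆r y∈p
... | inj₂ y∈q = q⊆r y∈q

#-subsets : ∀ (V : Subset N) → #ˢ (_⊆? V) ≤ 2 ^ ∣ V ∣
#-subsets [] = s≤s z≤n
#-subsets {suc N} (s ∷ V) = begin
  # (_⊆? (s ∷ V)) (map (inside ∷_) As ++ map (outside ∷_) As)
    ≡⟨ #-++ (_⊆? (s ∷ V)) (map (inside ∷_) As) (map (outside ∷_) As) ⟩
  # (_⊆? (s ∷ V)) (map (inside ∷_) As) + # (_⊆? (s ∷ V)) (map (outside ∷_) As)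
    ≡⟨ cong₂ _+_ (#-map (_⊆? (s ∷ V)) (inside ∷_) As) (#-map (_⊆? (s ∷ V)) (outside ∷_) As) ⟩
  #ˢ (λ A → (inside ∷ A) ⊆? (s ∷ V)) + #ˢ (λ A → (outside ∷ A) ⊆? (s ∷ V))
    ≤⟨ +-monoʳ-≤ (#ˢ (λ A → (inside ∷ A) ⊆? (s ∷ V)))
         (≤-trans (#-mono (λ A → (outside ∷ A) ⊆? (s ∷ V)) (_⊆? V) drop-∷-⊆ As) (#-subsets V)) ⟩
  #ˢ (λ A → (inside ∷ A) ⊆? (s ∷ V)) + 2 ^ ∣ V ∣
    ≤⟨ with-head s ⟩
  2 ^ ∣ s ∷ V ∣ ∎
  where
  open ≤-Reasoning
  As = allSubsets N
  head-in : ∀ {A} → ¬ (inside ∷ A ⊆ outside ∷ V)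
  head-in A⊆ with A⊆ Vec.here
  ... | ()
  with-head : ∀ s → #ˢ (λ A → (inside ∷ A) ⊆? (s ∷ V)) + 2 ^ ∣ V ∣ ≤ 2 ^ ∣ s ∷ V ∣
  with-head outside = +-monoˡ-≤ _ (≤-reflexive (#-none (λ A → (inside ∷ A) ⊆? (outside ∷ V)) As head-in))
  with-head inside = begin
    #ˢ (λ A → (inside ∷ A) ⊆? (inside ∷ V)) + 2 ^ ∣ V ∣
      ≤⟨ +-monoˡ-≤ _ (≤-trans (#-mono (λ A → (inside ∷ A) ⊆? (inside ∷ V)) (_⊆? V) drop-∷-⊆ As) (#-subsets V)) ⟩
    2 ^ ∣ V ∣ + 2 ^ ∣ V ∣
      ≡⟨ cong (2 ^ ∣ V ∣ +_) (+-identityʳ _) ⟨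
    2 * 2 ^ ∣ V ∣ ∎

^-distribʳ-* : ∀ m n o → (m * n) ^ o ≡ m ^ o * n ^ o
^-distribʳ-* m n zero = refl
^-distribʳ-* m n (suc o) = trans (cong (m * n *_) (^-distribʳ-* m n o)) (shuffle m n (m ^ o) (n ^ o))
  where
  shuffle : ∀ a b c d → a * b * (c * d) ≡ a * c * (b * d)
  shuffle = solve-∀

n<2^n : ∀ n → n < 2 ^ n
n<2^n zero = s≤s z≤n
n<2^n (suc n) = begin-strict
  suc n                  ≤⟨ n<2^n n ⟩
  2 ^ n                  <⟨ m<m+n (2 ^ n) (m^n>0 2 n) ⟩
  2 ^ n + 2 ^ n          ≡⟨ cong (2 ^ n +_) (+-identityʳ _) ⟨
  2 ^ suc n              ∎
  where open ≤-Reasoning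

module Kernel {N t i : ℕ} .{{_ : NonZero i}}
  {H W : Subset N → Set} (W? : Decidable W)
  (W⇒H : ∀ {A} → W A → H A)
  (W-size : ∀ {A} → W A → ∣ A ∣ ≡ i)
  (H-size : ∀ {B} → H B → ∣ B ∣ ≤ i)
  (H-meets : ∀ {A B} → H A → H B → t ≤ ∣ A ∩ B ∣)
  (minimal : ∀ {A V} → W A → V ⊆ A → ∣ V ∣ < i → ∃ λ B → H B × ∣ V ∩ B ∣ < t)
  where

  Above : Subset N → Subset N → Set
  Above V A = W A × V ⊆ A

  above? : ∀ V → Decidable (Above V)
  above? V A = W? A ×-dec (V ⊆? A)

  -- Branching. While |V| < i, some B in H meets V in fewer than t points, but every A in W meets B
  -- in at least t. So each A above V contains one of the at most i points of B ─ V, which is added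
  -- to V. After at most d additions V has i points and determines A.
  above-count : ∀ d V → i ≤ ∣ V ∣ + d → #ˢ (above? V) ≤ i ^ d
  -- The search is for a set A above V: `minimal` speaks about subsets of members of W, so it needs
  -- such an A.
  above-count d V i≤ with anySubset? (above? V) | i ≤? ∣ V ∣
  ... | no none | _ = ≤-trans (≤-reflexive (#-none (above? V) (allSubsets N) λ w → none (_ , w))) z≤n
  ... | yes _ | yes i≤∣V∣ = ≤-trans
    (#-subsingleton (above? V) (allSubsets-unique N) λ a b → trans (sym (V≡ a)) (V≡ b))
    (m^n>0 i d)
    where
    V≡ : ∀ {A} → Above V A → V ≡ A
    V≡ (w , V⊆A) = p⊆q∧∣q∣≤∣p∣⇒p≡q V⊆A (≤-trans (≤-reflexive (W-size w)) i≤∣V∣)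
  above-count zero V i≤ | yes _ | no i≰∣V∣ = contradiction (≤-trans i≤ (≤-reflexive (+-identityʳ _))) i≰∣V∣
  above-count (suc d) V i≤ | yes (A , w , V⊆A) | no i≰∣V∣ with minimal w V⊆A (≰⇒> i≰∣V∣)
  ... | B , B∈H , ∣V∩B∣<t = begin
    #ˢ (above? V)                        ≤⟨ cover-count T? (above? V) (_∈? (B ─ V)) (allSubsets N) (allFin N) (i ^ d)
                                              (proj₁ ∘ proj₂) covered few ⟩
    i ^ d * # (_∈? (B ─ V)) (allFin N)   ≡⟨ cong (i ^ d *_) (∣p∣≡# (B ─ V)) ⟨
    i ^ d * ∣ B ─ V ∣                    ≤⟨ *-monoʳ-≤ (i ^ d) (≤-trans (∣p─q∣≤∣p∣ B V) (H-size B∈H)) ⟩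
    i ^ d * i                            ≡⟨ *-comm (i ^ d) i ⟩
    i ^ suc d                            ∎
    where
    open ≤-Reasoning
    T : Subset N → Fin N → Set
    T A y = Above V A × y ∈ B ─ V × y ∈ A
    T? : ∀ A y → Dec (T A y)
    T? A y = above? V A ×-dec (y ∈? (B ─ V)) ×-dec (y ∈? A)
    covered : ∀ {A} → Above V A → ∃ λ y → y ∈ₗ allFin N × T A y
    covered {A} a@(w , _) with ∣p∣<∣q∣⇒∃∈q∉p (<-≤-trans ∣V∩B∣<t (H-meets (W⇒H w) B∈H))
    ... | y , y∈A∩B , y∉V∩B = let y∈A , y∈B = x∈p∩q⁻ A B y∈A∩B in
      y , ∈-allFin y , a , x∈p∧x∉q⇒x∈p─q y∈B (λ y∈V → y∉V∩B (x∈p∩q⁺ (y∈V , y∈B))) , y∈A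
    few : ∀ {y} → y ∈ B ─ V → #ˢ (λ A → T? A y) ≤ i ^ d
    few {y} y∈ = ≤-trans
      (#-mono (λ A → T? A y) (above? (V ∪ ⁅ y ⁆)) (λ ((w , V⊆A) , _ , y∈A) → w , p∪⁅x⁆⊆q V⊆A y∈A) (allSubsets N))
      (above-count d (V ∪ ⁅ y ⁆) (begin
        i                   ≤⟨ i≤ ⟩
        ∣ V ∣ + suc d       ≡⟨ +-suc ∣ V ∣ d ⟩
        suc ∣ V ∣ + d       ≡⟨ cong (_+ d) (∣p∪⁅x⁆∣≡1+∣p∣ (x∈p─q⇒x∉q B V y∈)) ⟨
        ∣ V ∪ ⁅ y ⁆ ∣ + d   ∎))

  AboveMissing : ℕ → Subset N → Subset N → Subset N → Set
  AboveMissing s Z E A = Above E A × ∣ Z ─ A ∣ ≤ s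

  above-missing? : ∀ s Z E → Decidable (AboveMissing s Z E)
  above-missing? s Z E A = above? E A ×-dec (∣ Z ─ A ∣ ≤? s)

  Missing : ℕ → Subset N → Subset N → Subset N → Set
  Missing s Z E A = AboveMissing s Z E A × ∃ λ x → x ∈ Z × x ∉ A

  missing? : ∀ s Z E → Decidable (Missing s Z E)
  missing? s Z E A with ⊆-or-witness Z A
  ... | inj₁ Z⊆A = no λ (_ , x , x∈Z , x∉A) → x∉A (Z⊆A x∈Z)
  ... | inj₂ wit with above-missing? s Z E A
  ...   | yes m = yes (m , wit)
  ...   | no ¬m = no (¬m ∘ proj₁)

  -- Either A contains Z, and then it lies above Z ∪ E, which leaves at most i ^ g choices; or A
  -- misses some y in Z, and after one of at most i choices of y the count goes on with Z - y, s - 1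
  -- and g - 1. Each of the at most s + 1 levels thus contributes at most i ^ g.
  above-missing-count : ∀ s g Z E → (∀ {x} → x ∈ Z → x ∉ E) → ∣ Z ∣ ≤ i →
    i + (s + s) ≤ ∣ Z ∣ + ∣ E ∣ + g → #ˢ (above-missing? s Z E) ≤ suc s * i ^ g
  missing-count : ∀ s g Z E → (∀ {x} → x ∈ Z → x ∉ E) → ∣ Z ∣ ≤ i → s ≤ g →
    i + (s + s) ≤ ∣ Z ∣ + ∣ E ∣ + g → #ˢ (missing? s Z E) ≤ s * i ^ g

  above-missing-count s g Z E disjoint ∣Z∣≤i i+2s≤ with anySubset? (above-missing? s Z E)
  ... | no none = ≤-trans (≤-reflexive (#-none (above-missing? s Z E) (allSubsets N) λ w → none (_ , w))) z≤n
  ... | yes (A , (w , E⊆A) , ∣Z─A∣≤s) = begin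
    #ˢ (above-missing? s Z E)
      ≤⟨ #-⊎ (above-missing? s Z E) (above? (Z ∪ E)) (missing? s Z E) split (allSubsets N) ⟩
    #ˢ (above? (Z ∪ E)) + #ˢ (missing? s Z E)
      ≤⟨ +-mono-≤ (above-count g (Z ∪ E) i≤) (missing-count s g Z E disjoint ∣Z∣≤i s≤g i+2s≤) ⟩
    i ^ g + s * i ^ g ∎
    where
    open ≤-Reasoning
    split : ∀ {A} → AboveMissing s Z E A → Above (Z ∪ E) A ⊎ Missing s Z E A
    split {A} m@((w , E⊆A) , _) with ⊆-or-witness Z A
    ... | inj₁ Z⊆A = inj₁ (w , ∪-least Z⊆A E⊆A)
    ... | inj₂ wit = inj₂ (m , wit)
    i≤ : i ≤ ∣ Z ∪ E ∣ + g
    i≤ = begin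
      i                     ≤⟨ m≤m+n i (s + s) ⟩
      i + (s + s)           ≤⟨ i+2s≤ ⟩
      ∣ Z ∣ + ∣ E ∣ + g     ≡⟨ cong (_+ g) (∣p∪q∣≡∣p∣+∣q∣ disjoint) ⟨
      ∣ Z ∪ E ∣ + g         ∎
    -- The set A found above gives |Z| + |E| ≤ s + |A| = s + i. Hence g does not run out before s in
    -- the recursion.
    s≤g : s ≤ g
    s≤g = +-cancelˡ-≤ (i + s) s g (begin
      i + s + s                             ≡⟨ +-assoc i s s ⟩
      i + (s + s)                           ≤⟨ i+2s≤ ⟩
      ∣ Z ∣ + ∣ E ∣ + g                     ≤⟨ +-monoˡ-≤ g (begin
        ∣ Z ∣ + ∣ E ∣                         ≡⟨ cong (_+ ∣ E ∣) (∣p─q∣+∣p∩q∣≡∣p∣ Z A) ⟨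
        ∣ Z ─ A ∣ + ∣ Z ∩ A ∣ + ∣ E ∣         ≡⟨ +-assoc ∣ Z ─ A ∣ _ _ ⟩
        ∣ Z ─ A ∣ + (∣ Z ∩ A ∣ + ∣ E ∣)       ≡⟨ cong (∣ Z ─ A ∣ +_) (∣p∪q∣≡∣p∣+∣q∣ (disjoint ∘ p∩q⊆p Z A)) ⟨
        ∣ Z ─ A ∣ + ∣ (Z ∩ A) ∪ E ∣           ≤⟨ +-mono-≤ ∣Z─A∣≤s (p⊆q⇒∣p∣≤∣q∣ (∪-least (p∩q⊆q Z A) E⊆A)) ⟩
        s + ∣ A ∣                             ≡⟨ cong (s +_) (W-size w) ⟩
        s + i                                 ≡⟨ +-comm s i ⟩
        i + s                                 ∎) ⟩
      i + s + g                             ∎)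

  missing-count zero g Z E disjoint ∣Z∣≤i s≤g i+2s≤ = ≤-reflexive
    (#-none (missing? zero Z E) (allSubsets N) λ ((_ , ∣Z─A∣≤0) , x , x∈Z , x∉A) →
      <⇒≱ (≤-trans (≤-reflexive (sym (∣⁅x⁆∣≡1 x))) (p⊆q⇒∣p∣≤∣q∣ λ y∈x →
        subst (_∈ _) (sym (x∈⁅y⁆⇒x≡y x y∈x)) (x∈p∧x∉q⇒x∈p─q x∈Z x∉A))) ∣Z─A∣≤0)
  missing-count (suc s) (suc g) Z E disjoint ∣Z∣≤i (s≤s s≤g) i+2s≤ = begin
    #ˢ (missing? (suc s) Z E)
      ≤⟨ cover-count T? (missing? (suc s) Z E) (_∈? Z) (allSubsets N) (allFin N) (suc s * i ^ g)
           (proj₁ ∘ proj₂) (λ m@(a , y , y∈Z , y∉A) → y , ∈-allFin y , a , y∈Z , y∉A) few ⟩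
    suc s * i ^ g * # (_∈? Z) (allFin N)   ≡⟨ cong (suc s * i ^ g *_) (∣p∣≡# Z) ⟨
    suc s * i ^ g * ∣ Z ∣                  ≤⟨ *-monoʳ-≤ (suc s * i ^ g) ∣Z∣≤i ⟩
    suc s * i ^ g * i                      ≡⟨ *-assoc (suc s) (i ^ g) i ⟩
    suc s * (i ^ g * i)                    ≡⟨ cong (suc s *_) (*-comm (i ^ g) i) ⟩
    suc s * i ^ suc g                      ∎
    where
    open ≤-Reasoning
    T : Subset N → Fin N → Set
    T A y = AboveMissing (suc s) Z E A × y ∈ Z × y ∉ A
    T? : ∀ A y → Dec (T A y)
    T? A y = above-missing? (suc s) Z E A ×-dec (y ∈? Z) ×-dec ¬? (y ∈? A)
    few : ∀ {y} → y ∈ Z → #ˢ (λ A → T? A y) ≤ suc s * i ^ g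
    few {y} y∈Z = ≤-trans
      (#-mono (λ A → T? A y) (above-missing? s (Z - y) E) fewer-missing (allSubsets N))
      -- Deleting y lowers s, |Z| and g by one each, so both sides of the size inequality drop by
      -- two.
      (above-missing-count s g (Z - y) E (disjoint ∘ p─q⊆p Z ⁅ y ⁆)
        (≤-trans (∣p─q∣≤∣p∣ Z ⁅ y ⁆) ∣Z∣≤i) (≤-pred (≤-pred (begin
          2 + (i + (s + s))                      ≡⟨ lhs i s ⟩
          i + (suc s + suc s)                    ≤⟨ i+2s≤ ⟩
          ∣ Z ∣ + ∣ E ∣ + suc g                  ≡⟨ cong (λ z → z + ∣ E ∣ + suc g) (∣p∣≡1+∣p-x∣ y∈Z) ⟩
          suc ∣ Z - y ∣ + ∣ E ∣ + suc g          ≡⟨ +-suc (suc (∣ Z - y ∣ + ∣ E ∣)) g ⟩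
          2 + (∣ Z - y ∣ + ∣ E ∣ + g)            ∎))))
      where
      lhs : ∀ i s → 2 + (i + (s + s)) ≡ i + (suc s + suc s)
      lhs = solve-∀
      fewer-missing : ∀ {A} → T A y → AboveMissing s (Z - y) E A
      fewer-missing {A} ((a , ∣Z─A∣≤) , _ , y∉A) = a , ≤-pred (begin
        suc ∣ (Z - y) ─ A ∣   ≡⟨ cong (suc ∘ ∣_∣) (p─q─r≡p─r─q Z ⁅ y ⁆ A) ⟩
        suc ∣ (Z ─ A) - y ∣   ≡⟨ ∣p∣≡1+∣p-x∣ (x∈p∧x∉q⇒x∈p─q y∈Z y∉A) ⟨
        ∣ Z ─ A ∣             ≤⟨ ∣Z─A∣≤ ⟩
        suc s                 ∎)

  -- Take two members U₁, U₂ of H with |U₁ ∩ U₂| = t.  Every A in W meets U₁ and U₂ in at least t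
  -- points each, so each point of Z = U₁ ∩ U₂ that A misses is paid for by two points of
  -- E = A ∩ ((U₁ ∪ U₂) ─ Z).  There are at most 4ᵐ sets E.
  kernel-count : ∀ m → i ≡ t + m → #ˢ W? ≤ (8 * i) ^ m
  kernel-count m i≡t+m with anySubset? W?
  ... | no none = ≤-trans (≤-reflexive (#-none W? (allSubsets N) λ w → none (_ , w))) z≤n
  ... | yes (U₁ , U₁∈W) = from-pair (nonempty-of-size U₁ (≤-trans (>-nonZero⁻¹ i) (≤-reflexive (sym (W-size U₁∈W)))))
    where
    open ≤-Reasoning
    nonempty-of-size : ∀ U → 0 < ∣ U ∣ → ∃ λ x → x ∈ U
    nonempty-of-size U 0<∣U∣ with ∣p∣<∣q∣⇒∃∈q∉p {p = ∅} (≤-trans (≤-reflexive (cong suc (∣⊥∣≡0 N))) 0<∣U∣)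
    ... | x , x∈U , _ = x , x∈U

    from-pair : (∃ λ x → x ∈ U₁) → #ˢ W? ≤ (8 * i) ^ m
    -- U₁ - x is smaller than i, so `minimal` yields a U₂ meeting it in fewer than t points. Putting
    -- x back adds at most one point, hence |U₁ ∩ U₂| = t.
    from-pair (x , x∈U₁) = from-U₂ (minimal U₁∈W (p─q⊆p U₁ ⁅ x ⁆)
      (≤-trans (≤-reflexive (sym (∣p∣≡1+∣p-x∣ x∈U₁))) (≤-reflexive (W-size U₁∈W))))
      where
      from-U₂ : (∃ λ U₂ → H U₂ × ∣ (U₁ - x) ∩ U₂ ∣ < t) → #ˢ W? ≤ (8 * i) ^ m
      from-U₂ (U₂ , U₂∈H , <t) = begin
        -- W is sorted by the traces E = A ∩ V. In the final 8ᵐ, a factor 4ᵐ counts the traces and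
        -- 2ᵐ bounds the factor s + 1 from `above-missing-count`.
        #ˢ W?
          ≤⟨ cover-count T? W? (_⊆? V) (allSubsets N) (allSubsets N) (2 ^ m * i ^ m)
               (λ (_ , E⊆V , _) → E⊆V) (λ {A} w → A ∩ V , ∈-allSubsets _ , w , p∩q⊆q A V , refl) few ⟩
        2 ^ m * i ^ m * #ˢ (_⊆? V)
          ≤⟨ *-monoʳ-≤ (2 ^ m * i ^ m) (≤-trans (#-subsets V) (^-monoʳ-≤ 2 ∣V∣≤2m)) ⟩
        2 ^ m * i ^ m * 2 ^ (m + m)
          ≡⟨ cong (2 ^ m * i ^ m *_) (^-distribˡ-+-* 2 m m) ⟩
        2 ^ m * i ^ m * (2 ^ m * 2 ^ m)
          ≡⟨ shuffle (2 ^ m) (i ^ m) ⟩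
        2 ^ m * (2 ^ m * 2 ^ m) * i ^ m
          ≡⟨ cong (_* i ^ m) (trans (cong (2 ^ m *_) (sym (^-distribʳ-* 2 2 m))) (sym (^-distribʳ-* 2 4 m))) ⟩
        8 ^ m * i ^ m
          ≡⟨ ^-distribʳ-* 8 i m ⟨
        (8 * i) ^ m ∎
        where
        shuffle : ∀ a b → a * b * (a * a) ≡ a * (a * a) * b
        shuffle = solve-∀
        Z = U₁ ∩ U₂
        V = (U₁ ∪ U₂) ─ Z
        ∣Z∣≡t : ∣ Z ∣ ≡ t
        ∣Z∣≡t = ≤-antisym
          (begin
            ∣ Z ∣                       ≤⟨ ∣p∣≤1+∣p-x∣ Z x ⟩
            suc ∣ Z - x ∣               ≤⟨ s≤s (p⊆q⇒∣p∣≤∣q∣ λ y∈ →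
                                            let y∈U₁ , y∈U₂ = x∈p∩q⁻ U₁ U₂ (p─q⊆p Z ⁅ x ⁆ y∈) in
                                            x∈p∩q⁺ (x∈p∧x≢y⇒x∈p-y y∈U₁ (x∈p-y⇒x≢y Z x y∈) , y∈U₂)) ⟩
            suc ∣ (U₁ - x) ∩ U₂ ∣       ≤⟨ <t ⟩
            t                           ∎)
          (H-meets (W⇒H U₁∈W) U₂∈H)
        ∣V∣≤2m : ∣ V ∣ ≤ m + m
        ∣V∣≤2m = +-cancelʳ-≤ (t + t) ∣ V ∣ (m + m) (begin
          ∣ V ∣ + (t + t)                     ≡⟨ +-assoc ∣ V ∣ t t ⟨
          ∣ V ∣ + t + t                       ≡⟨ cong (λ z → ∣ V ∣ + z + z) ∣Z∣≡t ⟨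
          ∣ V ∣ + ∣ Z ∣ + ∣ Z ∣               ≤⟨ +-monoˡ-≤ ∣ Z ∣ (+-monoʳ-≤ ∣ V ∣ (p⊆q⇒∣p∣≤∣q∣ λ z∈ →
                                                  x∈p∩q⁺ (p⊆p∪q U₂ (p∩q⊆p U₁ U₂ z∈) , z∈))) ⟩
          ∣ V ∣ + ∣ (U₁ ∪ U₂) ∩ Z ∣ + ∣ Z ∣   ≡⟨ cong (_+ ∣ Z ∣) (∣p─q∣+∣p∩q∣≡∣p∣ (U₁ ∪ U₂) Z) ⟩
          ∣ U₁ ∪ U₂ ∣ + ∣ Z ∣                 ≡⟨ ∣p∪q∣+∣p∩q∣≡∣p∣+∣q∣ U₁ U₂ ⟩
          ∣ U₁ ∣ + ∣ U₂ ∣                     ≤⟨ +-mono-≤ (H-size (W⇒H U₁∈W)) (H-size U₂∈H) ⟩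
          i + i                               ≡⟨ cong (λ j → j + j) i≡t+m ⟩
          t + m + (t + m)                     ≡⟨ regroup t m ⟩
          m + m + (t + t)                     ∎)
          where
          regroup : ∀ t m → t + m + (t + m) ≡ m + m + (t + t)
          regroup = solve-∀
        T : Subset N → Subset N → Set
        T A E = W A × E ⊆ V × E ≡ A ∩ V
        T? : ∀ A E → Dec (T A E)
        T? A E = W? A ×-dec (E ⊆? V) ×-dec (E ≟ˢ (A ∩ V))
        few : ∀ {E} → E ⊆ V → #ˢ (λ A → T? A E) ≤ 2 ^ m * i ^ m
        few {E} E⊆V = begin
          #ˢ (λ A → T? A E)            ≤⟨ #-mono (λ A → T? A E) (above-missing? s Z E) paid (allSubsets N) ⟩
          #ˢ (above-missing? s Z E)    ≤⟨ above-missing-count s m Z E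
                                            (λ z∈Z z∈E → x∈p─q⇒x∉q (U₁ ∪ U₂) Z (E⊆V z∈E) z∈Z)
                                            (≤-trans (≤-reflexive ∣Z∣≡t) (≤-trans (m≤m+n t m) (≤-reflexive (sym i≡t+m))))
                                            enough ⟩
          suc s * i ^ m                ≤⟨ *-monoˡ-≤ (i ^ m) (≤-trans (s≤s s≤m) (n<2^n m)) ⟩
          2 ^ m * i ^ m                ∎
          where
          -- Two points of E pay for one missed point of Z; rounding down is allowed because the
          -- number of missed points is an integer.
          s = ⌊ ∣ E ∣ /2⌋
          s≤m : s ≤ m
          s≤m = ≤-trans (⌊n/2⌋-mono (≤-trans (p⊆q⇒∣p∣≤∣q∣ E⊆V) ∣V∣≤2m)) (≤-reflexive (sym (n≡⌊n+n/2⌋ m)))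
          enough : i + (s + s) ≤ ∣ Z ∣ + ∣ E ∣ + m
          enough = begin
            i + (s + s)            ≤⟨ +-monoʳ-≤ i (≤-trans (+-monoʳ-≤ s (⌊n/2⌋≤⌈n/2⌉ ∣ E ∣)) (≤-reflexive (⌊n/2⌋+⌈n/2⌉≡n ∣ E ∣))) ⟩
            i + ∣ E ∣              ≡⟨ cong (_+ ∣ E ∣) i≡t+m ⟩
            t + m + ∣ E ∣          ≡⟨ regroup t m ∣ E ∣ ⟩
            t + ∣ E ∣ + m          ≡⟨ cong (λ z → z + ∣ E ∣ + m) ∣Z∣≡t ⟨
            ∣ Z ∣ + ∣ E ∣ + m      ∎
            where
            regroup : ∀ t m e → t + m + e ≡ t + e + m
            regroup = solve-∀
          -- The sum |A ∩ U₁| + |A ∩ U₂| is at least 2t and at most |E| + 2|Z ∩ A|. Since t = |Z ─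
          -- A| + |Z ∩ A|, cancelling leaves 2|Z ─ A| ≤ |E|.
          paid : ∀ {A} → T A E → AboveMissing s Z E A
          paid {A} (w , _ , refl) = (w , p∩q⊆p A V) ,
            ≤-trans (≤-reflexive (n≡⌊n+n/2⌋ ∣ Z ─ A ∣)) (⌊n/2⌋-mono (+-cancelʳ-≤ (c + c) (z + z) ∣ E ∣ (begin
              z + z + (c + c)                             ≡⟨ regroup z c ⟩
              (z + c) + (z + c)                           ≡⟨ cong (λ n → n + n) (trans (∣p─q∣+∣p∩q∣≡∣p∣ Z A) ∣Z∣≡t) ⟩
              t + t                                       ≤⟨ +-mono-≤ (H-meets (W⇒H w) (W⇒H U₁∈W)) (H-meets (W⇒H w) U₂∈H) ⟩
              ∣ A ∩ U₁ ∣ + ∣ A ∩ U₂ ∣                     ≡⟨ ∣p∪q∣+∣p∩q∣≡∣p∣+∣q∣ (A ∩ U₁) (A ∩ U₂) ⟨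
              ∣ (A ∩ U₁) ∪ (A ∩ U₂) ∣ + ∣ (A ∩ U₁) ∩ (A ∩ U₂) ∣
                ≤⟨ +-mono-≤ (p⊆q⇒∣p∣≤∣q∣ (∪-least (in-E∪Z p⊆∪) (in-E∪Z q⊆∪)))
                            (p⊆q⇒∣p∣≤∣q∣ in-Z) ⟩
              ∣ (A ∩ V) ∪ (Z ∩ A) ∣ + c                   ≤⟨ +-monoˡ-≤ c (≤-trans (m≤m+n _ _) (≤-reflexive (∣p∪q∣+∣p∩q∣≡∣p∣+∣q∣ (A ∩ V) (Z ∩ A)))) ⟩
              ∣ A ∩ V ∣ + c + c                           ≡⟨ +-assoc ∣ A ∩ V ∣ c c ⟩
              ∣ A ∩ V ∣ + (c + c)                         ∎)))
            where
            z = ∣ Z ─ A ∣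
            c = ∣ Z ∩ A ∣
            regroup : ∀ z c → z + z + (c + c) ≡ (z + c) + (z + c)
            regroup = solve-∀
            p⊆∪ : U₁ ⊆ U₁ ∪ U₂
            p⊆∪ = p⊆p∪q U₂
            q⊆∪ : U₂ ⊆ U₁ ∪ U₂
            q⊆∪ = q⊆p∪q U₁ U₂
            in-E∪Z : ∀ {U} → U ⊆ U₁ ∪ U₂ → A ∩ U ⊆ (A ∩ V) ∪ (Z ∩ A)
            in-E∪Z {U} U⊆ {y} y∈ with x∈p∩q⁻ A U y∈ | y ∈? Z
            ... | y∈A , _ | yes y∈Z = q⊆p∪q (A ∩ V) (Z ∩ A) (x∈p∩q⁺ (y∈Z , y∈A))
            ... | y∈A , y∈U | no y∉Z = p⊆p∪q (Z ∩ A) (x∈p∩q⁺ (y∈A , x∈p∧x∉q⇒x∈p─q (U⊆ y∈U) y∉Z))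
            in-Z : (A ∩ U₁) ∩ (A ∩ U₂) ⊆ Z ∩ A
            in-Z y∈ = let y∈₁ , y∈₂ = x∈p∩q⁻ (A ∩ U₁) (A ∩ U₂) y∈
                          y∈A , y∈U₁ = x∈p∩q⁻ A U₁ y∈₁
                          _ , y∈U₂ = x∈p∩q⁻ A U₂ y∈₂
                      in x∈p∩q⁺ (x∈p∩q⁺ (y∈U₁ , y∈U₂) , y∈A)

-- Saturation and peeling

Intersecting : ℕ → (Subset N → Set) → Set
Intersecting t G = ∀ {A B} → G A → G B → t ≤ ∣ A ∩ B ∣

-- A maximal t-intersecting family between G and D. The field `saturated` names what keeps a set of
-- D out: it is too small to meet even itself in t points, or it conflicts with a member of H.
record Saturation (t : ℕ) (G D : Subset N → Set) : Set₁ where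
  field
    H : Subset N → Set
    H? : Decidable H
    G⇒H : ∀ {A} → G A → H A
    H⇒D : ∀ {A} → H A → D A
    intersecting : Intersecting t H
    saturated : ∀ {A} → D A → H A ⊎ (∣ A ∣ < t ⊎ ∃ λ B → H B × ∣ A ∩ B ∣ < t)

-- Greedy: run through all subsets and add each set of D that is compatible with the family built so
-- far.
saturate : ∀ {t} {G D : Subset N → Set} → Decidable G → Decidable D →
  (∀ {A} → G A → D A) → Intersecting t G → Saturation t G D
saturate {N} {t} {G} {D} G? D? G⇒D G-int = record
  { H = H ; H? = H? ; G⇒H = G⇒H ; H⇒D = H⇒D ; intersecting = H-int
  ; saturated = saturated (∈-allSubsets _) }
  where
  record Partial (As : List (Subset N)) : Set₁ where
    field
      H : Subset N → Set
      H? : Decidable H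
      G⇒H : ∀ {A} → G A → H A
      H⇒D : ∀ {A} → H A → D A
      H-int : Intersecting t H
      saturated : ∀ {A} → A ∈ₗ As → D A → H A ⊎ (∣ A ∣ < t ⊎ ∃ λ B → H B × ∣ A ∩ B ∣ < t)

  go : ∀ As → Partial As
  go [] = record { H = G ; H? = G? ; G⇒H = λ g → g ; H⇒D = G⇒D ; H-int = G-int ; saturated = λ () }
  go (A ∷ As) = extend (D? A) (∣ A ∣ <? t) (anySubset? λ B → H? B ×-dec (∣ A ∩ B ∣ <? t))
    where
    open Partial (go As)
    skip : (D A → H A ⊎ (∣ A ∣ < t ⊎ ∃ λ B → H B × ∣ A ∩ B ∣ < t)) → Partial (A ∷ As)
    skip A-done = record
      { H = H ; H? = H? ; G⇒H = G⇒H ; H⇒D = H⇒D ; H-int = H-int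
      ; saturated = λ { (here refl) → A-done ; (there B∈) → saturated B∈ } }
    extend : Dec (D A) → Dec (∣ A ∣ < t) → Dec (∃ λ B → H B × ∣ A ∩ B ∣ < t) → Partial (A ∷ As)
    extend (no ¬d) _ _ = skip λ d → contradiction d ¬d
    extend (yes _) (yes <t) _ = skip λ _ → inj₂ (inj₁ <t)
    extend (yes _) (no _) (yes conflict) = skip λ _ → inj₂ (inj₂ conflict)
    extend (yes d) (no ≮t) (no compatible) = record
      { H = λ B → H B ⊎ B ≡ A
      ; H? = λ B → H? B ⊎-dec (B ≟ˢ A)
      ; G⇒H = inj₁ ∘ G⇒H
      ; H⇒D = λ { (inj₁ h) → H⇒D h ; (inj₂ refl) → d }
      ; H-int = λ
          { (inj₁ h) (inj₁ h′) → H-int h h′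
          ; {B} (inj₁ h) (inj₂ refl) → subst (t ≤_) (cong ∣_∣ (∩-comm A B)) (A-meets h)
          ; (inj₂ refl) (inj₁ h) → A-meets h
          ; (inj₂ refl) (inj₂ refl) → subst (t ≤_) (cong ∣_∣ (sym (∩-idem A))) (≮⇒≥ ≮t) }
      ; saturated = λ
          { (here refl) _ → inj₁ (inj₂ refl)
          ; (there B∈) d′ → weaken (saturated B∈ d′) } }
      where
      A-meets : ∀ {B} → H B → t ≤ ∣ A ∩ B ∣
      A-meets h = ≮⇒≥ λ <t → compatible (_ , h , <t)
      -- Obstructions found earlier persist, because the family only grows.
      weaken : ∀ {C} → H C ⊎ (∣ C ∣ < t ⊎ ∃ λ B → H B × ∣ C ∩ B ∣ < t) →
        (H C ⊎ C ≡ A) ⊎ (∣ C ∣ < t ⊎ ∃ λ B → (H B ⊎ B ≡ A) × ∣ C ∩ B ∣ < t)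
      weaken (inj₁ h) = inj₁ (inj₁ h)
      weaken (inj₂ (inj₁ <t)) = inj₂ (inj₁ <t)
      weaken (inj₂ (inj₂ (B , h , <t))) = inj₂ (inj₂ (B , inj₁ h , <t))

  open Partial (go (allSubsets N))

-- Non-triviality with explicit witnesses, which suits families given as predicates.
Unpinned : ℕ → (Subset N → Set) → Set
Unpinned t G = ∀ T → ∣ T ∣ ≡ t → ∃ λ B → G B × T ⊈ B

-- The given T serves to produce a member A. Meeting itself in t points, A has exactly t elements;
-- every other member meets A in all of them. So A itself is a common t-set.
t-sets-pinned : ∀ {t} {G : Subset N → Set} → (∃ λ T → ∣ T ∣ ≡ t) →
  (∀ {A} → G A → ∣ A ∣ ≤ t) → Intersecting t G → ¬ Unpinned t G
t-sets-pinned (T , ∣T∣≡t) small int unpinned with unpinned T ∣T∣≡t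
... | A , A∈G , _ with unpinned A (≤-antisym (small A∈G) (≤-trans (int A∈G A∈G) (∣p∩q∣≤∣p∣ A A)))
...   | B , B∈G , A⊈B = A⊈B (subst (_⊆ B)
        (p⊆q∧∣q∣≤∣p∣⇒p≡q (p∩q⊆p A B) (≤-trans (small A∈G) (int A∈G B∈G))) (p∩q⊆q A B))

module Bound {N n : ℕ} (𝓒 : Family N) (complex : IsSimplicialComplex 𝓒)
  (large : ∀ A → IsMaximalIn A 𝓒 → n ≤ ∣ A ∣) (k t : ℕ) .{{_ : NonZero k}}
  (room : 64 * k * k + k ≤ n)
  (M : ℕ) (M-max : ∀ T → ∣ T ∣ ≡ t → Complex.deg 𝓒 complex large k T ≤ M)
  (t-set : ∃ λ (T : Subset N) → ∣ T ∣ ≡ t) where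

  open Complex 𝓒 complex large k

  -- This is `deg-remove` with r = 64k², for which `room` leaves space, after cancelling one factor
  -- k.
  deg-shrink : ∀ {W x} → x ∈ W → 64 * k * deg W ≤ deg (W - x)
  deg-shrink {W} {x} x∈W = *-cancelˡ-≤ k (≤-trans (≤-reflexive (shuffle k (deg W))) (deg-remove room x∈W))
    where
    shuffle : ∀ k d → k * (64 * k * d) ≡ 64 * k * k * d
    shuffle = solve-∀

  deg-bound : ∀ m W → ∣ W ∣ ≡ t + m → (64 * k) ^ m * deg W ≤ M
  deg-bound zero W ∣W∣≡ = ≤-trans (≤-reflexive (*-identityˡ _)) (M-max W (trans ∣W∣≡ (+-identityʳ t)))
  deg-bound (suc m) W ∣W∣≡ with nonempty? W
  ... | no empty = contradiction
    (trans (sym (∣⊥∣≡0 N)) (trans (cong ∣_∣ (sym (Empty-unique empty))) (trans ∣W∣≡ (+-suc t m)))) λ ()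
  ... | yes (x , x∈W) = begin
    c * c ^ m * deg W       ≡⟨ shuffle c (c ^ m) (deg W) ⟩
    c ^ m * (c * deg W)     ≤⟨ *-monoʳ-≤ (c ^ m) (deg-shrink x∈W) ⟩
    c ^ m * deg (W - x)     ≤⟨ deg-bound m (W - x) (suc-injective (trans (sym (∣p∣≡1+∣p-x∣ x∈W)) (trans ∣W∣≡ (+-suc t m)))) ⟩
    M                       ∎
    where
    open ≤-Reasoning
    c = 64 * k
    shuffle : ∀ a b d → a * b * d ≡ b * (a * d)
    shuffle = solve-∀

  -- In the form |𝓐| ≤ (1/2 − 1/2ʲ⁺¹) M, for the family 𝓐 of all P.
  unpinned-bound : ∀ j {G P : Subset N → Set} (G? : Decidable G) (P? : Decidable P) → t + j ≤ k →
    (∀ {A} → G A → ∣ A ∣ ≤ t + j) → Intersecting t G → Unpinned t G →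
    (∀ {A} → P A → A ∈F 𝓒 × ∣ A ∣ ≡ k) → (∀ {A} → P A → ∃ λ B → G B × B ⊆ A) →
    2 ^ suc j * #ˢ P? + M ≤ 2 ^ j * M
  -- The base case is vacuous: t-intersecting sets of size at most t share a t-set.
  unpinned-bound zero G? P? _ G-size G-int unpinned _ _ =
    contradiction unpinned (t-sets-pinned t-set (λ g → ≤-trans (G-size g) (≤-reflexive (+-identityʳ t))) G-int)
  unpinned-bound (suc j) {G} {P} G? P? i≤k G-size G-int unpinned P-layer P-above = conclude
    where
    open ≤-Reasoning
    i = t + suc j
    instance
      i≢0 : NonZero i
      i≢0 = >-nonZero (≤-trans (s≤s z≤n) (≤-reflexive (sym (+-suc t j))))
    D : Subset N → Set
    D A = ∃ λ B → G B × A ⊆ B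
    open Saturation (saturate {D = D} G? (λ A → anySubset? λ B → G? B ×-dec (A ⊆? B)) (λ g → _ , g , λ x∈ → x∈) G-int)

    Small : Subset N → Set
    Small A = H A × ∣ A ∣ < i
    small? : Decidable Small
    small? A = H? A ×-dec (∣ A ∣ <? i)
    above-small? : Decidable (λ A → ∃ λ B → Small B × B ⊆ A)
    above-small? A = anySubset? λ B → small? B ×-dec (B ⊆? A)
    W : Subset N → Set
    W A = H A × ∣ A ∣ ≡ i × ¬ ∃ λ B → Small B × B ⊆ A
    W? : Decidable W
    W? A = H? A ×-dec (∣ A ∣ ≟ i) ×-dec ¬? (above-small? A)

    H-size : ∀ {A} → H A → ∣ A ∣ ≤ i
    H-size h = let B , g , A⊆B = H⇒D h in ≤-trans (p⊆q⇒∣p∣≤∣q∣ A⊆B) (G-size g)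

    minimal : ∀ {A V} → W A → V ⊆ A → ∣ V ∣ < i → ∃ λ B → H B × ∣ V ∩ B ∣ < t
    minimal {A} {V} (h , _ , none) V⊆A ∣V∣<i with saturated (let B , g , A⊆B = H⇒D h in B , g , ⊆-trans V⊆A A⊆B)
    ... | inj₁ V∈H = ⊥-elim (none (V , (V∈H , ∣V∣<i) , V⊆A))
    -- A set V with fewer than t points cannot meet anything in t points, so A itself serves as B.
    ... | inj₂ (inj₁ ∣V∣<t) = A , h , ≤-<-trans (∣p∩q∣≤∣p∣ V A) ∣V∣<t
    ... | inj₂ (inj₂ conflict) = conflict

    W-count : #ˢ W? ≤ (8 * i) ^ suc j
    W-count = Kernel.kernel-count {t = t} {i} {H} W? proj₁ (proj₁ ∘ proj₂) H-size intersecting minimal (suc j) refl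

    P₁ P₂ : Subset N → Set
    P₁ A = P A × ∃ λ B → W B × B ⊆ A
    P₂ A = P A × ∃ λ B → Small B × B ⊆ A
    P₁? : Decidable P₁
    P₁? A = P? A ×-dec anySubset? λ B → W? B ×-dec (B ⊆? A)
    P₂? : Decidable P₂
    P₂? A = P? A ×-dec above-small? A

    split : ∀ {A} → P A → P₁ A ⊎ P₂ A
    split p with P-above p
    ... | B , g , B⊆A with above-small? B
    ...   | yes (B′ , small , B′⊆B) = inj₂ (p , B′ , small , ⊆-trans B′⊆B B⊆A)
    -- With no small set below it, B has size exactly i, for otherwise B would be a small set below
    -- itself.
    ...   | no none = inj₁ (p , B , (G⇒H g , ≤-antisym (G-size g) (≮⇒≥ λ <i → none (B , (G⇒H g , <i) , λ x∈ → x∈)) , none) , B⊆A)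

    p₁ p₂ a : ℕ
    p₁ = #ˢ P₁?
    p₂ = #ˢ P₂?
    a = 2 ^ j

    -- Each of the at most (8k)^(j+1) sets in W captures at most M / (64k)^(j+1) of the k-sets, and
    -- 64k = 8k · 8.
    p₁-scaled : 8 ^ suc j * p₁ ≤ M
    p₁-scaled = *-cancelˡ-≤ ((8 * k) ^ suc j) {{m^n≢0 (8 * k) (suc j) {{m*n≢0 8 k}}}} (begin
      (8 * k) ^ suc j * (8 ^ suc j * p₁)   ≡⟨ *-assoc ((8 * k) ^ suc j) _ p₁ ⟨
      (8 * k) ^ suc j * 8 ^ suc j * p₁     ≡⟨ cong (_* p₁) (^-distribʳ-* (8 * k) 8 (suc j)) ⟨
      (8 * k * 8) ^ suc j * p₁             ≡⟨ cong (λ b → b ^ suc j * p₁) (64k k) ⟩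
      (64 * k) ^ suc j * p₁                ≤⟨ scaled-cover-count T? P₁? W? (allSubsets N) (allSubsets N) ((64 * k) ^ suc j) M
                                                (proj₁ ∘ proj₂) (λ (p , B , w , B⊆A) → B , ∈-allSubsets B , p , w , B⊆A) few ⟩
      M * #ˢ W?                            ≤⟨ *-monoʳ-≤ M (≤-trans W-count (^-monoˡ-≤ (suc j) (*-monoʳ-≤ 8 i≤k))) ⟩
      M * (8 * k) ^ suc j                  ≡⟨ *-comm M _ ⟩
      (8 * k) ^ suc j * M                  ∎)
      where
      64k : ∀ k → 8 * k * 8 ≡ 64 * k
      64k = solve-∀
      T : Subset N → Subset N → Set
      T A B = P A × W B × B ⊆ A
      T? : ∀ A B → Dec (T A B)
      T? A B = P? A ×-dec W? B ×-dec (B ⊆? A)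
      few : ∀ {B} → W B → (64 * k) ^ suc j * #ˢ (λ A → T? A B) ≤ M
      few {B} (_ , ∣B∣≡i , _) = ≤-trans
        (*-monoʳ-≤ ((64 * k) ^ suc j) (#-mono (λ A → T? A B) (star? B) (λ (p , _ , B⊆A) → P-layer p , B⊆A) (allSubsets N)))
        (deg-bound (suc j) B ∣B∣≡i)

    8ap₁≤M : 8 * a * p₁ ≤ M
    8ap₁≤M = ≤-trans (*-monoˡ-≤ p₁ (begin
      8 * a            ≤⟨ *-monoʳ-≤ 8 (^-monoˡ-≤ j (s≤s (s≤s z≤n))) ⟩
      8 * 8 ^ j        ∎)) p₁-scaled

    4ap+M≤ : 4 * a * #ˢ P? + M ≤ 4 * a * p₁ + 4 * a * p₂ + M
    4ap+M≤ = +-monoˡ-≤ M (≤-trans (*-monoʳ-≤ (4 * a) (#-⊎ P? P₁? P₂? split (allSubsets N)))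
      (≤-reflexive (*-distribˡ-+ (4 * a) p₁ p₂)))

    pinned-case : ∀ T → ∣ T ∣ ≡ t → (∀ {B} → Small B → T ⊆ B) → 4 * a * p₁ + 4 * a * p₂ + M ≤ 2 * a * M
    pinned-case T ∣T∣≡t pinned with unpinned T ∣T∣≡t
    -- Doubling makes 8 a p₁ ≤ M applicable and turns the p₂ term into a * (8 p₂), at most a M. The
    -- remaining 3 M is at most 3 a M because a ≥ 1.
    ... | B₀ , B₀∈G , T⊈B₀ = *-cancelˡ-≤ 2 (begin
      2 * (4 * a * p₁ + 4 * a * p₂ + M)     ≡⟨ expand a p₁ p₂ M ⟩
      8 * a * p₁ + a * (8 * p₂) + 2 * M     ≤⟨ +-monoˡ-≤ (2 * M) (+-mono-≤ 8ap₁≤M (*-monoʳ-≤ a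
                                                 (≤-trans (*-monoˡ-≤ p₂ (m≤m+n 8 56)) 64p₂≤M))) ⟩
      M + a * M + 2 * M                     ≡⟨ collect a M ⟩
      a * M + 3 * M                         ≤⟨ +-monoʳ-≤ (a * M) (*-monoʳ-≤ 3 (≤-trans (≤-reflexive (sym (*-identityˡ M)))
                                                 (*-monoˡ-≤ M (m^n>0 2 j)))) ⟩
      a * M + 3 * (a * M)                   ≡⟨ double a M ⟩
      2 * (2 * a * M)                       ∎)
      where
      expand : ∀ a p q M → 2 * (4 * a * p + 4 * a * q + M) ≡ 8 * a * p + a * (8 * q) + 2 * M
      expand = solve-∀
      collect : ∀ a M → M + a * M + 2 * M ≡ a * M + 3 * M
      collect = solve-∀
      double : ∀ a M → a * M + 3 * (a * M) ≡ 2 * (2 * a * M)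
      double = solve-∀
      shuffle : ∀ k p → k * (64 * p) ≡ 64 * k * p
      shuffle = solve-∀
      ∣T∩B₀∣<t : ∣ T ∩ B₀ ∣ < t
      ∣T∩B₀∣<t = ≰⇒> λ t≤ → T⊈B₀ (subst (_⊆ B₀)
        (p⊆q∧∣q∣≤∣p∣⇒p≡q (p∩q⊆p T B₀) (≤-trans (≤-reflexive ∣T∣≡t) t≤)) (p∩q⊆q T B₀))
      S : Subset N → Fin N → Set
      S A y = Star (T ∪ ⁅ y ⁆) A × y ∈ B₀ ─ T
      S? : ∀ A y → Dec (S A y)
      S? A y = star? (T ∪ ⁅ y ⁆) A ×-dec (y ∈? (B₀ ─ T))
      -- B meets B₀ in at least t points and T in fewer of them, so B has a point y in B₀ ─ T. Hence
      -- A contains T ∪ {y}.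
      covered : ∀ {A} → P₂ A → ∃ λ y → y ∈ₗ allFin N × S A y
      covered (p , B , small , B⊆A) with ∣p∣<∣q∣⇒∃∈q∉p (<-≤-trans ∣T∩B₀∣<t (intersecting (proj₁ small) (G⇒H B₀∈G)))
      ... | y , y∈B∩B₀ , y∉T∩B₀ = let y∈B , y∈B₀ = x∈p∩q⁻ B B₀ y∈B∩B₀ in
        y , ∈-allFin y , (P-layer p , p∪⁅x⁆⊆q (⊆-trans (pinned small) B⊆A) (B⊆A y∈B)) ,
        x∈p∧x∉q⇒x∈p─q y∈B₀ (λ y∈T → y∉T∩B₀ (x∈p∩q⁺ (y∈T , y∈B₀)))
      few : ∀ {y} → y ∈ B₀ ─ T → 64 * k * #ˢ (λ A → S? A y) ≤ M
      few {y} y∈ = ≤-trans (*-monoʳ-≤ (64 * k) (#-mono (λ A → S? A y) (star? (T ∪ ⁅ y ⁆)) proj₁ (allSubsets N)))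
        (≤-trans (≤-reflexive (cong (_* deg (T ∪ ⁅ y ⁆)) (sym (*-identityʳ (64 * k)))))
          (deg-bound 1 (T ∪ ⁅ y ⁆) (trans (∣p∪⁅x⁆∣≡1+∣p∣ (x∈p─q⇒x∉q B₀ T y∈)) (trans (cong suc ∣T∣≡t) (+-comm 1 t)))))
      64p₂≤M : 64 * p₂ ≤ M
      64p₂≤M = *-cancelˡ-≤ k (begin
        k * (64 * p₂)                     ≡⟨ shuffle k p₂ ⟩
        64 * k * p₂                       ≤⟨ scaled-cover-count S? P₂? (_∈? (B₀ ─ T)) (allSubsets N) (allFin N) (64 * k) M
                                               proj₂ covered few ⟩
        M * # (_∈? (B₀ ─ T)) (allFin N)   ≡⟨ cong (M *_) (∣p∣≡# (B₀ ─ T)) ⟨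
        M * ∣ B₀ ─ T ∣                    ≤⟨ *-monoʳ-≤ M (≤-trans (∣p─q∣≤∣p∣ B₀ T) (≤-trans (G-size B₀∈G) i≤k)) ⟩
        M * k                             ≡⟨ *-comm M k ⟩
        k * M                             ∎)

    -- From j to j + 1 the permitted bound grows by M / (4a), and p₁ fits into this increase; the
    -- induction hypothesis handles p₂.
    unpinned-case : Unpinned t Small → 4 * a * p₁ + 4 * a * p₂ + M ≤ 2 * a * M
    unpinned-case still-unpinned = begin
      4 * a * p₁ + 4 * a * p₂ + M           ≤⟨ +-monoˡ-≤ M (+-monoˡ-≤ (4 * a * p₂)
                                                 (≤-trans (*-monoˡ-≤ p₁ (*-monoˡ-≤ a (m≤m+n 4 4))) 8ap₁≤M)) ⟩
      M + 4 * a * p₂ + M                    ≡⟨ collect a p₂ M ⟩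
      2 * (2 * a * p₂ + M)                  ≤⟨ *-monoʳ-≤ 2 (unpinned-bound j small? P₂? (≤-trans (+-monoʳ-≤ t (n≤1+n j)) i≤k)
                                                 (λ (_ , <i) → ≤-pred (≤-trans <i (≤-reflexive (+-suc t j))))
                                                 (λ (h , _) (h′ , _) → intersecting h h′) still-unpinned
                                                 (P-layer ∘ proj₁) proj₂) ⟩
      2 * (a * M)                           ≡⟨ *-assoc 2 a M ⟨
      2 * a * M                             ∎
      where
      collect : ∀ a q M → M + 4 * a * q + M ≡ 2 * (2 * a * q + M)
      collect = solve-∀

    missing? : ∀ T → Dec (∃ λ B → Small B × T ⊈ B)
    missing? T = anySubset? λ B → small? B ×-dec ¬? (T ⊆? B)

    cases : 4 * a * p₁ + 4 * a * p₂ + M ≤ 2 * a * M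
    -- If `Small` is empty, the first case applies: any t-set lies vacuously in all its members, and
    -- `t-set` shows that one exists.
    cases with anySubset? (λ T → (∣ T ∣ ≟ t) ×-dec ¬? (missing? T))
    ... | yes (T , ∣T∣≡t , none) =
      pinned-case T ∣T∣≡t λ {B} small {x} → decidable-stable (T ⊆? B) (λ T⊈B → none (B , small , T⊈B))
    ... | no none = unpinned-case λ T ∣T∣≡t → decidable-stable (missing? T) λ ¬missing → none (T , ∣T∣≡t , ¬missing)

    conclude : 2 ^ suc (suc j) * #ˢ P? + M ≤ 2 ^ suc j * M
    conclude = ≤-trans (≤-reflexive (cong (λ b → b * #ˢ P? + M) (sym (*-assoc 2 2 a)))) (≤-trans 4ap+M≤ cases)

-- Boolean membership, common intersections and maximisers

does⇒ : {P : Set} (P? : Dec P) → does P? ≡ true → P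
does⇒ (yes p) _ = p
does⇒ (no _) ()

⋂F-lower : (𝓕 : Family N) (A : Subset N) → A ∈F 𝓕 → ⋂F 𝓕 ⊆ A
⋂F-lower {N} 𝓕 A A∈𝓕 = go (∈-allSubsets A)
  where
  go : ∀ {As} → A ∈ₗ As → foldr (λ B acc → if 𝓕 B then B ∩ acc else acc) ⊤ As ⊆ A
  go {_ ∷ As} (here refl) rewrite A∈𝓕 = p∩q⊆p A _
  go {B ∷ As} (there A∈As) with 𝓕 B
  ... | true = ⊆-trans (p∩q⊆q B _) (go A∈As)
  ... | false = go A∈As

⋂F-greatest : (𝓕 : Family N) (T : Subset N) → (∀ {A} → A ∈F 𝓕 → T ⊆ A) → T ⊆ ⋂F 𝓕
⋂F-greatest {N} 𝓕 T lower = go (allSubsets N)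
  where
  go : ∀ As → T ⊆ foldr (λ B acc → if 𝓕 B then B ∩ acc else acc) ⊤ As
  go [] = ⊆⊤
  go (B ∷ As) x∈T with 𝓕 B in eq
  ... | true = x∈p∩q⁺ (lower eq x∈T , go As x∈T)
  ... | false = go As x∈T

max-subset : {P : Subset N → Set} (f : Subset N → ℕ) → Decidable P → ∃ P →
  ∃ λ T → P T × ∀ T′ → P T′ → f T′ ≤ f T
-- The default value T₀ of `argmax` satisfies P, so the maximiser does as well.
max-subset {N} {P} f P? (T₀ , P₀) = argmax f T₀ candidates ,
  argmax-all f P₀ (all-filter P? (allSubsets N)) ,
  λ T PT → All.lookup (f[xs]≤f[argmax] T₀ candidates) (∈-filter⁺ P? (∈-allSubsets T) PT)
  where candidates = filter P? (allSubsets N)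

-- The size hypothesis in polynomial form

2^-cancel-≤ : ∀ {m n} → 2 ^ m ≤ 2 ^ n → m ≤ n
2^-cancel-≤ le = ≮⇒≥ λ n<m → <⇒≱ (^-monoʳ-< 2 (s≤s (s≤s z≤n)) n<m) le

-- The linear term is absorbed by k ≤ k², which makes 65 out of 64 + 1.
64k²+k≤ck² : ∀ c k → 65 ≤ c → 64 * k * k + k ≤ c * k ^ 2
64k²+k≤ck² c k 65≤c = begin
  64 * k * k + k          ≤⟨ +-monoʳ-≤ (64 * k * k) (m≤m*k k) ⟩
  64 * k * k + k * k      ≡⟨ collect k ⟩
  65 * (k * (k * 1))      ≤⟨ *-monoˡ-≤ (k ^ 2) 65≤c ⟩
  c * k ^ 2               ∎
  where
  open ≤-Reasoning
  m≤m*k : ∀ m → m ≤ m * m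
  m≤m*k zero = z≤n
  m≤m*k (suc m) = m≤m*n (suc m) (suc m)
  collect : ∀ k → 64 * k * k + k * k ≡ 65 * (k * (k * 1))
  collect = solve-∀

-- The premise is n ≥ c k² log₂ k with the logarithm exponentiated away; for k ≥ 2 that logarithm is
-- at least 1.
linear-room : ∀ c k n → 65 ≤ c → 2 ≤ k → k ^ (c * k ^ 2) ≤ 2 ^ n → 64 * k * k + k ≤ n
linear-room c k n 65≤c 2≤k le =
  ≤-trans (64k²+k≤ck² c k 65≤c) (2^-cancel-≤ (≤-trans (^-monoˡ-≤ (c * k ^ 2) 2≤k) le))

-- Stars, non-trivial families and families of maximum size

module Families {N n k t : ℕ} (0<n : 0 < n) (0<k : 0 < k) (0<t : 0 < t) (t≤k : t ≤ k)
  (𝓒 : Family N) (complex : IsSimplicialComplex 𝓒)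
  (large : ∀ A → IsMaximalIn A 𝓒 → n ≤ ∣ A ∣)
  (room : 2 ≤ k → 64 * k * k + k ≤ n) where

  open Complex 𝓒 complex large k

  t≤n : t ≤ n
  t≤n with 2 ≤? k
  ... | yes 2≤k = ≤-trans t≤k (≤-trans (m≤n+m k (64 * k * k)) (room 2≤k))
  ... | no 2≰k = ≤-trans t≤k (≤-trans (≤-pred (≰⇒> 2≰k)) 0<n)

  -- The empty face extends to a maximal one, which already has n points.
  n≤N : n ≤ N
  n≤N = let M , _ , maximal = extend-to-maximal 𝓒 ∅ (proj₁ complex) in ≤-trans (large M maximal) (∣p∣≤n M)

  t-set : ∃ λ (T : Subset N) → ∣ T ∣ ≡ t
  t-set = let T , _ , ∣T∣≡t = subset-of-size ⊤ t (≤-trans (≤-trans t≤n n≤N) (≤-reflexive (sym (∣⊤∣≡n N)))) in T , ∣T∣≡t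

  layer⇒ : ∀ {A} → A ∈F layer 𝓒 k → A ∈F 𝓒 × ∣ A ∣ ≡ k
  layer⇒ {A} A∈ = Bool.∧-conicalˡ (𝓒 A) _ A∈ , does⇒ (∣ A ∣ ≟ k) (Bool.∧-conicalʳ (𝓒 A) _ A∈)

  star⇒layer : ∀ T → star 𝓒 k T ⊆F layer 𝓒 k
  star⇒layer T A A∈ = Bool.∧-conicalˡ (layer 𝓒 k A) _ A∈

  star⇒⊆ : ∀ T {A} → A ∈F star 𝓒 k T → T ⊆ A
  star⇒⊆ T {A} A∈ = does⇒ (T ⊆? A) (Bool.∧-conicalʳ (layer 𝓒 k A) _ A∈)

  star-intro : ∀ T {A} → A ∈F layer 𝓒 k → T ⊆ A → A ∈F star 𝓒 k T
  star-intro T {A} A∈ T⊆A = cong₂ _∧_ A∈ (dec-true (T ⊆? A) T⊆A)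

  size-star : ∀ T → size (star 𝓒 k T) ≡ deg T
  size-star T = size≡#ˢ (star 𝓒 k T) (star? T)
    (λ {A} A∈ → layer⇒ (star⇒layer T A A∈) , star⇒⊆ T A∈)
    (λ {A} ((A∈𝓒 , ∣A∣≡k) , T⊆A) → star-intro T (cong₂ _∧_ A∈𝓒 (dec-true (∣ A ∣ ≟ k) ∣A∣≡k)) T⊆A)

  star-intersecting : ∀ T → ∣ T ∣ ≡ t → IsTIntersecting t (star 𝓒 k T)
  star-intersecting T ∣T∣≡t A B A∈ B∈ =
    ≤-trans (≤-reflexive (sym ∣T∣≡t)) (p⊆q⇒∣p∣≤∣q∣ λ x∈T → x∈p∩q⁺ (star⇒⊆ T A∈ x∈T , star⇒⊆ T B∈ x∈T))

  nontrivial⇒unpinned : (𝓕 : Family N) → IsNontrivial t 𝓕 → Unpinned t (_∈F 𝓕)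
  nontrivial⇒unpinned 𝓕 ⋂<t T ∣T∣≡t with anySubset? (λ B → (𝓕 B Bool.≟ true) ×-dec ¬? (T ⊆? B))
  ... | yes w = w
  ... | no none = contradiction
    (≤-trans (≤-reflexive (sym ∣T∣≡t)) (p⊆q⇒∣p∣≤∣q∣ (⋂F-greatest 𝓕 T λ {B} B∈𝓕 {x} →
      decidable-stable (T ⊆? B) (λ T⊈B → none (B , B∈𝓕 , T⊈B)))))
    (<⇒≱ ⋂<t)

  -- This is `unpinned-bound` with 𝓕 as both the generating and the counted family, j = k - t, and M
  -- the largest degree of a t-set, attained at T.
  nontrivial : (𝓕 : Family N) → 𝓕 ⊆F layer 𝓒 k → IsTIntersecting t 𝓕 → IsNontrivial t 𝓕 →
    Σ (Subset N) λ T → (∣ T ∣ ≡ t) × (2 * size 𝓕 ≤ size (star 𝓒 k T))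
  nontrivial 𝓕 𝓕⊆layer 𝓕-int ⋂<t with max-subset deg (λ T → ∣ T ∣ ≟ t) t-set | t ≟ k
  -- For t = k no non-trivial family exists, since t-intersecting t-sets coincide.
  ... | _ | yes refl = contradiction (nontrivial⇒unpinned 𝓕 ⋂<t)
    (t-sets-pinned t-set (λ A∈ → ≤-reflexive (proj₂ (layer⇒ (𝓕⊆layer _ A∈)))) (λ {A} {B} → 𝓕-int A B))
  ... | T , ∣T∣≡t , T-max | no t≢k = T , ∣T∣≡t , *-cancelˡ-≤ (2 ^ j) {{m^n≢0 2 j}} (begin
    2 ^ j * (2 * size 𝓕)             ≡⟨ shuffle (2 ^ j) (size 𝓕) ⟩
    2 ^ suc j * size 𝓕               ≡⟨ cong (2 ^ suc j *_) (size≡#ˢ 𝓕 member? (λ A∈ → A∈) (λ A∈ → A∈)) ⟩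
    2 ^ suc j * #ˢ member?           ≤⟨ m≤m+n _ (deg T) ⟩
    2 ^ suc j * #ˢ member? + deg T   ≤⟨ Bound.unpinned-bound 𝓒 complex large k t {{>-nonZero 0<k}}
                                          -- From 0 < t < k follows k ≥ 2, so `room` is available.
                                          (room (≤-trans (s≤s 0<t) (≤∧≢⇒< t≤k t≢k))) (deg T) T-max t-set
                                          j member? member? (≤-reflexive t+j≡k)
                                          (λ A∈ → ≤-reflexive (trans (proj₂ (layer⇒ (𝓕⊆layer _ A∈))) (sym t+j≡k)))
                                          (λ {A} {B} → 𝓕-int A B) (nontrivial⇒unpinned 𝓕 ⋂<t)
                                          (λ A∈ → layer⇒ (𝓕⊆layer _ A∈)) (λ A∈ → _ , A∈ , λ x∈ → x∈) ⟩
    2 ^ j * deg T                    ≡⟨ cong (2 ^ j *_) (size-star T) ⟨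
    2 ^ j * size (star 𝓒 k T)        ∎)
    where
    open ≤-Reasoning
    j = k ∸ t
    t+j≡k : t + j ≡ k
    t+j≡k = m+[n∸m]≡n t≤k
    member? : Decidable (_∈F 𝓕)
    member? A = 𝓕 A Bool.≟ true
    shuffle : ∀ a s → a * (2 * s) ≡ 2 * a * s
    shuffle = solve-∀

  -- A non-trivial 𝓕 would satisfy 2|𝓕| ≤ |star| ≤ |𝓕|, the second step by maximality, which is
  -- absurd as 𝓕 has a member. Otherwise 𝓕 lies in the star of a t-set from its common intersection,
  -- and a proper inclusion would make that star larger.
  maximum : (𝓕 : Family N) → 𝓕 ⊆F layer 𝓒 k → IsTIntersecting t 𝓕 →
    (∀ (𝓖 : Family N) → 𝓖 ⊆F layer 𝓒 k → IsTIntersecting t 𝓖 → size 𝓖 ≤ size 𝓕) →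
    Σ (Subset N) λ T → (∣ T ∣ ≡ t) × (𝓕 ≡F star 𝓒 k T)
  maximum 𝓕 𝓕⊆layer 𝓕-int 𝓕-max with ∣ ⋂F 𝓕 ∣ <? t
  ... | yes ⋂<t = ⊥-elim (<⇒≱ (*-monoˡ-< (size 𝓕) {{>-nonZero 0<size}} {1} {2} (s≤s (s≤s z≤n)))
                    (≤-trans 2size≤ (≤-trans (𝓕-max _ (star⇒layer T) (star-intersecting T ∣T∣≡t)) (≤-reflexive (sym (*-identityˡ _))))))
    where
    bounded = nontrivial 𝓕 𝓕⊆layer 𝓕-int ⋂<t
    T = proj₁ bounded
    ∣T∣≡t = proj₁ (proj₂ bounded)
    2size≤ = proj₂ (proj₂ bounded)
    0<size : 0 < size 𝓕
    0<size = let A , A∈𝓕 , _ = nontrivial⇒unpinned 𝓕 ⋂<t T ∣T∣≡t in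
      ≤-trans (#-positive (λ A → 𝓕 A Bool.≟ true) (∈-allSubsets A) A∈𝓕)
        (≤-reflexive (sym (size≡#ˢ 𝓕 (λ A → 𝓕 A Bool.≟ true) (λ A∈ → A∈) (λ A∈ → A∈))))
  -- An empty 𝓕 also falls under this case: its `⋂F` is the whole ground set, which has at least t
  -- points.
  ... | no ⋂≮t with subset-of-size (⋂F 𝓕) t (≮⇒≥ ⋂≮t)
  ...   | T , T⊆⋂ , ∣T∣≡t = T , ∣T∣≡t , λ A → Bool.⇔→≡ (mk⇔ (𝓕⊆star A) (star⊆𝓕 A))
    where
    𝓕⊆star : 𝓕 ⊆F star 𝓒 k T
    𝓕⊆star A A∈𝓕 = star-intro T (𝓕⊆layer A A∈𝓕) (⊆-trans T⊆⋂ (⋂F-lower 𝓕 A A∈𝓕))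
    star⊆𝓕 : star 𝓒 k T ⊆F 𝓕
    star⊆𝓕 A A∈star = decidable-stable (𝓕 A Bool.≟ true) λ A∉𝓕 → <⇒≱
      (begin-strict
        size 𝓕                                    ≡⟨ size≡#ˢ 𝓕 (λ B → 𝓕 B Bool.≟ true) (λ B∈ → B∈) (λ B∈ → B∈) ⟩
        #ˢ (λ B → 𝓕 B Bool.≟ true)                <⟨ #-mono-< (λ B → 𝓕 B Bool.≟ true) (λ B → star 𝓒 k T B Bool.≟ true)
                                                       (𝓕⊆star _) (∈-allSubsets A) A∉𝓕 A∈star ⟩
        #ˢ (λ B → star 𝓒 k T B Bool.≟ true)       ≡⟨ size≡#ˢ (star 𝓒 k T) (λ B → star 𝓒 k T B Bool.≟ true) (λ B∈ → B∈) (λ B∈ → B∈) ⟨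
        size (star 𝓒 k T)                         ∎)
      (𝓕-max _ (star⇒layer T) (star-intersecting T ∣T∣≡t))
      where open ≤-Reasoning

theorem6 : (N n k t : ℕ) → 0 < n → 0 < k → 0 < t → t ≤ k →
    (𝓒 : Family N) → IsSimplicialComplex 𝓒 →
    (∀ (A : Subset N) → IsMaximalIn A 𝓒 → n ≤ ∣ A ∣) →
    k ^ (2 ^ 18 * k ^ 2) ≤ 2 ^ n →
    ((𝓕 : Family N) → 𝓕 ⊆F layer 𝓒 k → IsTIntersecting t 𝓕 →
    (∀ (𝓖 : Family N) → 𝓖 ⊆F layer 𝓒 k → IsTIntersecting t 𝓖 → size 𝓖 ≤ size 𝓕) →
    Σ (Subset N) λ T → (∣ T ∣ ≡ t) × (𝓕 ≡F star 𝓒 k T))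
    ×
    ((𝓕 : Family N) → 𝓕 ⊆F layer 𝓒 k → IsTIntersecting t 𝓕 → IsNontrivial t 𝓕 →
    Σ (Subset N) λ T → (∣ T ∣ ≡ t) × (2 * size 𝓕 ≤ size (star 𝓒 k T)))
theorem6 N n k t 0<n 0<k 0<t t≤k 𝓒 complex large n-large =
  Families.maximum 0<n 0<k 0<t t≤k 𝓒 complex large room , Families.nontrivial 0<n 0<k 0<t t≤k 𝓒 complex large room
  where
  -- For k = 1 the hypothesis reads 1 ≤ 2ⁿ and gives no bound on n, hence the restriction to k ≥ 2.
  room : 2 ≤ k → 64 * k * k + k ≤ n
  room 2≤k = linear-room (2 ^ 18) k n (≤ᵇ⇒≤ 65 (2 ^ 18) _) 2≤k n-large
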